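{- Let $C_{123}(x,p,q,r)=\sum_{n\geq0}x^n\sum_{\sigma\in\mathcal{Q}_n(123)}p^{\mathrm{plat}(\sigma)}q^{\mathrm{des}(\sigma)}r^{\mathrm{asc}(\sigma)}$, a formal power series in $x$. Then $f=q\,C_{123}(x,p,q,r)-q+1$ satisfies $$f=1+pqx\Big(-1+\big(2+x(pr+qr-pq)\big)f-pqx\big(1-x(p-r)(q-r)\big)f^2\Big)f.$$
   Context: A Stirling permutation of order $n$ is a permutation $\sigma=\sigma_1\cdots\sigma_{2n}$ of the multiset $\{1,1,2,2,\ldots,n,n\}$ such that, for each $i\in[n]$, every entry between the two occurrences of $i$ is greater than $i$; $\mathcal{Q}_n$ is the set of these ($\mathcal{Q}_0$ consists of the empty word). For $\sigma\in\mathcal{Q}_n$: $\mathrm{des}(\sigma)$, $\mathrm{asc}(\sigma)$, $\mathrm{plat}(\sigma)$ are the numbers of $i\in\{1,\dots,2n-1\}$ with $\sigma_i>\sigma_{i+1}$, $\sigma_i<\sigma_{i+1}$, $\sigma_i=\sigma_{i+1}$ respectively. $\mathcal{Q}_n(123)$ is the set of $\sigma\in\mathcal{Q}_n$ with no subsequence $\sigma_{i_1}<\sigma_{i_2}<\sigma_{i_3}$, $i_1<i_2<i_3$. -}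

module Defs where

open import Level using (Level)
open import Data.Nat using (ℕ; zero; suc; _∸_; _≡ᵇ_; _<ᵇ_)
  renaming (_+_ to _+ℕ_; _*_ to _*ℕ_)
open import Data.Bool using (Bool; true; false; _∧_; not; if_then_else_)
open import Data.List using (List; []; _∷_; map; _++_; length; foldr; concatMap; upTo; filter)
open import Data.List.Relation.Unary.All using (All)
open import Data.Product using (_×_; _,_)
open import Algebra.Bundles using (CommutativeRing)

pairs : List ℕ → List (ℕ × ℕ)
pairs []       = []
pairs (x ∷ xs) = map (λ y → (x , y)) xs ++ pairs xs

triples : List ℕ → List (ℕ × ℕ × ℕ)
triples []       = []
triples (x ∷ xs) = map (λ { (y , z) → (x , y , z) }) (pairs xs) ++ triples xs

adjacent : List ℕ → List (ℕ × ℕ)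
adjacent []           = []
adjacent (x ∷ [])     = []
adjacent (x ∷ y ∷ xs) = (x , y) ∷ adjacent (y ∷ xs)

countWhere : {A : Set} → (A → Bool) → List A → ℕ
countWhere P []       = 0
countWhere P (x ∷ xs) = (if P x then 1 else 0) +ℕ countWhere P xs

allB : {A : Set} → (A → Bool) → List A → Bool
allB P []       = true
allB P (x ∷ xs) = P x ∧ allB P xs

des asc plat : List ℕ → ℕ
des  w = countWhere (λ { (a , b) → b <ᵇ a }) (adjacent w)
asc  w = countWhere (λ { (a , b) → a <ᵇ b }) (adjacent w)
plat w = countWhere (λ { (a , b) → a ≡ᵇ b }) (adjacent w)

oneTo : ℕ → List ℕ
oneTo n = map suc (upTo n)

words : ℕ → ℕ → List (List ℕ)
words zero    n = [] ∷ []
words (suc k) n = concatMap (λ a → map (a ∷_) (words k n)) (oneTo n)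

isMultisetPerm : ℕ → List ℕ → Bool
isMultisetPerm n w =
  (length w ≡ᵇ (2 *ℕ n)) ∧
  allB (λ i → countWhere (λ a → a ≡ᵇ i) w ≡ᵇ 2) (oneTo n)

isStirlingCond : List ℕ → Bool
isStirlingCond w = allB (λ { (a , b , c) → not (a ≡ᵇ c) ∨ (a <ᵇ b) }) (triples w)
  where
    _∨_ : Bool → Bool → Bool
    true  ∨ _ = true
    false ∨ b = b

avoids123 : List ℕ → Bool
avoids123 w = allB (λ { (a , b , c) → not ((a <ᵇ b) ∧ (b <ᵇ c)) }) (triples w)

isStirling : ℕ → List ℕ → Bool
isStirling n w = isMultisetPerm n w ∧ isStirlingCond w

-- 𝒬_n(123), as an explicit list (each element listed once)
Q123 : ℕ → List (List ℕ)
Q123 n = filter (λ w → Data.Bool._≟_ (isStirling n w ∧ avoids123 w) true)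
                (words (2 *ℕ n) n)
  where import Data.Bool

module PowerSeries {c ℓ : Level} (R : CommutativeRing c ℓ) where
  open CommutativeRing R

  Series : Set c
  Series = ℕ → Carrier

  pow : Carrier → ℕ → Carrier
  pow a zero    = 1#
  pow a (suc n) = a * pow a n

  sumL : List Carrier → Carrier
  sumL = foldr _+_ 0#

  κ : Carrier → Series
  κ a zero    = a
  κ a (suc n) = 0#

  X· : Series → Series
  X· f zero    = 0#
  X· f (suc n) = f n

  _⊕_ : Series → Series → Series
  (f ⊕ g) n = f n + g n

  ⊖_ : Series → Series
  (⊖ f) n = - (f n)

  _⊝_ : Series → Series → Series
  f ⊝ g = f ⊕ (⊖ g)

  _⊗_ : Series → Series → Series
  (f ⊗ g) n = sumL (map (λ i → f i * g (n ∸ i)) (upTo (suc n)))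

  _·_ : Carrier → Series → Series
  (a · f) n = a * f n

  infixl 6 _⊕_ _⊝_
  infixl 7 _⊗_ _·_

  C123 : Carrier → Carrier → Carrier → Series
  C123 p q r n = sumL (map (λ σ → pow p (plat σ) * pow q (des σ) * pow r (asc σ)) (Q123 n))

{-# OPTIONS --safe #-}
module Submission where

open import Defs
open import Level using (Level)
open import Algebra.Bundles using (CommutativeRing; RawRing)
import Algebra.Properties.AbelianGroup as AbelianGroupProperties
import Algebra.Properties.CommutativeSemigroup as CommutativeSemigroupProperties
import Algebra.Properties.Group as GroupProperties
import Algebra.Properties.Ring as RingProperties
import Algebra.Properties.Semiring.Mult as SemiringMult
import Algebra.Solver.Ring as RingSolver
open import Algebra.Solver.Ring.AlmostCommutativeRing using (fromCommutativeRing; _-Raw-AlmostCommutative⟶_)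
open import Data.Bool using (Bool; true; _∧_; not; if_then_else_)
open import Data.Bool.Properties using (∧-conicalˡ; ∧-conicalʳ)
open import Data.Empty using (⊥; ⊥-elim)
open import Data.List using (List; []; _∷_; [_]; _++_; map; length; take; drop; concat; concatMap; applyUpTo; cartesianProductWith; initLast; _∷ʳ′_)
open import Data.List.Membership.Propositional using (_∈_; _∉_)
open import Data.List.Membership.Propositional.Properties
open import Data.List.Membership.Propositional.Properties.WithK using (unique∧set⇒bag)
open import Data.List.Properties using (map-applyUpTo; map-++; map-injective; length-map; length-++; length-take; length-drop; take-map; drop-map; take++drop≡id; ++-assoc; ++-identityʳ; ∷-injective; ∷-injectiveʳ; ∷ʳ-injective)
open import Data.List.Relation.Binary.BagAndSetEquality using (∼bag⇒↭)
open import Data.List.Relation.Binary.Disjoint.Propositional using (Disjoint)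
open import Data.List.Relation.Binary.Permutation.Propositional using (_↭_; prep; swap; ↭-sym; ↭-trans; ↭-reflexive)
open import Data.List.Relation.Binary.Permutation.Propositional.Properties using (↭-length; ∈-resp-↭; shift)
open import Data.List.Relation.Binary.Sublist.Propositional using (_⊆_; []; _∷_; _∷ʳ_; ⊆-refl; ⊆-reflexive; ⊆-trans; lookup; from∈; to∈; minimum)
open import Data.List.Relation.Binary.Sublist.Propositional.Properties using (++⁺; ++⁺ˡ; ++⁺ʳ; map⁺)
open import Data.List.Relation.Unary.All as All using ()
import Data.List.Relation.Unary.All.Properties as All
open import Data.List.Relation.Unary.AllPairs as AllPairs using ()
import Data.List.Relation.Unary.AllPairs.Properties as AllPairs
open import Data.List.Relation.Unary.Any using (here; there)
open import Data.List.Relation.Unary.Unique.Propositional using (Unique)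
import Data.List.Relation.Unary.Unique.Propositional.Properties as Unique
open import Data.Maybe using (Maybe; just; nothing)
open import Data.Nat as ℕ using (ℕ; zero; suc; _≤_; _<_; _≡ᵇ_; _<ᵇ_; z≤n; s≤s; _≟_; _<?_)
import Data.Nat.Properties as ℕ
open import Data.List.Membership.DecPropositional _≟_ using (_∈?_)
open import Data.Product using (_×_; _,_; proj₁; proj₂; ∃; ∃₂)
open import Data.Sum using (_⊎_; inj₁; inj₂; [_,_]′)
open import Function using (_∘_; mk⇔)
open import Relation.Binary.Definitions using (tri<; tri≈; tri>)
open import Relation.Binary.PropositionalEquality as ≡ using (_≡_)
import Relation.Binary.Reasoning.Setoid as SetoidReasoning
open import Relation.Nullary using (¬_; yes; no; contradiction)
open import Relation.Nullary.Decidable using (dec-true; dec-false)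

-- Build the words by inserting the two copies of a new smallest letter 1: in a 123-avoiding
-- Stirling permutation everything after the first 1 is weakly decreasing, so the word is
-- A 1 B 1 D where B and D are products of doubled letters and B D is decreasing.  Mark m of the
-- doubled letters ending a word A b₁b₁ … bₘbₘ with b₁ > … > bₘ, and let Aₘ(x) be the generating
-- function of such marked words in which the marked letters weigh p q each and A is weighted as
-- if it were followed by a smaller letter.  Then with y = p q x,
--   Aₘ = [m = 0] + y Aₘ₋₁ + x T_q T_p Aₘ,   T_c Aₘ = c Aₘ + r (Aₘ₊₁ + Aₘ₊₂ + …),
-- and f = A₀.  The recursion forces A_{k+m+1} = y A_k A_m, hence f = 1 + x f (p + r z)(q + r z)
-- with z = y f / (1 - y f), which is the cubic equation after clearing denominators.
-- To keep the sums finite, T is cut off at N terms and only coefficients up to x^N are compared.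

-- Once the other letters are raised by one, the two 1s can enter a word only at boundaries of a
-- terminal run of decreasing doubled letters, so the total for one order does not determine the
-- next; the marks are the catalytic parameter that repairs this. An arbitrary such suffix is
-- marked, not the longest one, so that a marked word and two cut points in its marked part
-- determine exactly one new word. The junction between A and the first marked letter is never
-- weighed, because marks are released only when a later 1 has been placed directly behind A. In T_c
-- the constant c is the step out of a 1 behind which nothing is released: p for the first 1, which
-- meets the second one, and q for the second 1, which meets a smaller letter or the end. If letters
-- are released, the step is an ascent, hence r. The infinite system of levels closes because the
-- product law gives A_m = y^m f^(m+1). Hence z = y (A₀ + A₁ + ...) is geometric in y f, and T_c
-- acts on every level as multiplication by c + r z.

module Words where

  -- Sublists and letter counts

  open import Data.Nat using (_+_)
  open import Relation.Binary.PropositionalEquality using (_≢_; refl; sym; trans; cong; cong₂; subst; subst₂; module ≡-Reasoning)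

  -- This is the case split behind every pattern check after an insertion: a triple misses the new
  -- letter, or its position in the triple tells on which side the other entries lie.
  ⊆-insert⁻ : ∀ {xs : List ℕ} A {x E} → xs ⊆ A ++ x ∷ E →
              xs ⊆ A ++ E ⊎ ∃₂ λ xs₁ xs₂ → xs ≡ xs₁ ++ x ∷ xs₂ × xs₁ ⊆ A × xs₂ ⊆ E
  ⊆-insert⁻ []      (_ ∷ʳ τ)      = inj₁ τ
  ⊆-insert⁻ []      (refl ∷ τ)    = inj₂ ([] , _ , refl , [] , τ)
  ⊆-insert⁻ (a ∷ A) (.a ∷ʳ τ)     with ⊆-insert⁻ A τ
  ... | inj₁ σ                      = inj₁ (a ∷ʳ σ)
  ... | inj₂ (xs₁ , xs₂ , eq , σ , ρ) = inj₂ (xs₁ , xs₂ , eq , a ∷ʳ σ , ρ)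
  ⊆-insert⁻ (a ∷ A) (refl ∷ τ)    with ⊆-insert⁻ A τ
  ... | inj₁ σ                      = inj₁ (refl ∷ σ)
  ... | inj₂ (xs₁ , xs₂ , eq , σ , ρ) = inj₂ (a ∷ xs₁ , xs₂ , cong (a ∷_) eq , refl ∷ σ , ρ)

  ⊆-map⁻ : ∀ {f : ℕ → ℕ} {xs} w → xs ⊆ map f w → ∃ λ ys → ys ⊆ w × xs ≡ map f ys
  ⊆-map⁻ []      []         = [] , [] , refl
  ⊆-map⁻ (a ∷ w) (_ ∷ʳ τ)   with ys , σ , eq ← ⊆-map⁻ w τ = ys , a ∷ʳ σ , eq
  ⊆-map⁻ {f} (a ∷ w) (refl ∷ τ) with ys , σ , eq ← ⊆-map⁻ w τ = a ∷ ys , refl ∷ σ , cong (f a ∷_) eq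

  ⊆-drop-mid : ∀ (A : List ℕ) {x E} → A ++ E ⊆ A ++ x ∷ E
  ⊆-drop-mid A {x} = ++⁺ (⊆-refl {x = A}) (x ∷ʳ ⊆-refl)

  cnt : ℕ → List ℕ → ℕ
  cnt i = countWhere (λ a → a ≡ᵇ i)

  cnt-here : ∀ i w → cnt i (i ∷ w) ≡ suc (cnt i w)
  cnt-here i w rewrite dec-true (i ≟ i) refl = refl

  cnt-skip : ∀ {i x} w → x ≢ i → cnt i (x ∷ w) ≡ cnt i w
  cnt-skip {i} {x} w x≢i rewrite dec-false (x ≟ i) x≢i = refl

  cnt-++ : ∀ i v w → cnt i (v ++ w) ≡ cnt i v + cnt i w
  cnt-++ i []      w = refl
  cnt-++ i (x ∷ v) w = trans (cong (_ +_) (cnt-++ i v w)) (sym (ℕ.+-assoc _ (cnt i v) (cnt i w)))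

  cnt-map-suc : ∀ i w → cnt (suc i) (map suc w) ≡ cnt i w
  cnt-map-suc i []      = refl
  cnt-map-suc i (x ∷ w) = cong (_ +_) (cnt-map-suc i w)

  cnt-↭ : ∀ i {v w} → v ↭ w → cnt i v ≡ cnt i w
  cnt-↭ i _↭_.refl         = refl
  cnt-↭ i (prep x v↭w)   = cong (_ +_) (cnt-↭ i v↭w)
  cnt-↭ i {x ∷ y ∷ v} (swap x y v↭w) = trans (sym (ℕ.+-assoc a b _))
    (trans (cong₂ _+_ (ℕ.+-comm a b) (cnt-↭ i v↭w)) (ℕ.+-assoc b a _))
    where
    a b : ℕ
    a = if x ≡ᵇ i then 1 else 0
    b = if y ≡ᵇ i then 1 else 0
  cnt-↭ i (_↭_.trans u↭v v↭w) = trans (cnt-↭ i u↭v) (cnt-↭ i v↭w)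

  ∉⇒cnt≡0 : ∀ {i} w → i ∉ w → cnt i w ≡ 0
  ∉⇒cnt≡0 []      i∉ = refl
  ∉⇒cnt≡0 (x ∷ w) i∉ = trans (cnt-skip {x = x} w (λ { refl → i∉ (here refl) })) (∉⇒cnt≡0 w (i∉ ∘ there))

  ∈⇒cnt≢0 : ∀ {i w} → i ∈ w → cnt i w ≢ 0
  ∈⇒cnt≢0 {i} {_ ∷ w} (here refl) eq with () ← trans (sym (cnt-here i w)) eq
  ∈⇒cnt≢0 {i} {x ∷ w} (there i∈) eq = ∈⇒cnt≢0 i∈ (ℕ.m+n≡0⇒n≡0 (if x ≡ᵇ i then 1 else 0) eq)

  first-occurrence : ∀ {i k} w → cnt i w ≡ suc k → ∃₂ λ u v → w ≡ u ++ i ∷ v × i ∉ u × cnt i v ≡ k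
  first-occurrence {i} (x ∷ w) eq with x ≟ i
  ... | yes refl = [] , w , refl , (λ ()) , ℕ.suc-injective (trans (sym (cnt-here i w)) eq)
  ... | no  x≢i  with u , v , refl , i∉u , eq′ ← first-occurrence w (trans (sym (cnt-skip w x≢i)) eq) =
    x ∷ u , v , refl , (λ { (here i≡x) → x≢i (sym i≡x) ; (there i∈u) → i∉u i∈u }) , eq′

  -- Doubled and decreasing words

  double : List ℕ → List ℕ
  double []      = []
  double (x ∷ B) = x ∷ x ∷ double B

  double-++ : ∀ B C → double (B ++ C) ≡ double B ++ double C
  double-++ []      C = refl
  double-++ (x ∷ B) C = cong (λ w → x ∷ x ∷ w) (double-++ B C)

  double-map : ∀ (f : ℕ → ℕ) B → double (map f B) ≡ map f (double B)
  double-map f []      = refl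
  double-map f (x ∷ B) = cong (λ w → f x ∷ f x ∷ w) (double-map f B)

  double-injective : ∀ {B C} → double B ≡ double C → B ≡ C
  double-injective {[]}    {[]}    eq = refl
  double-injective {x ∷ B} {y ∷ C} eq with refl , eq′ ← ∷-injective eq = cong (x ∷_) (double-injective (∷-injectiveʳ eq′))

  length-double : ∀ B → length (double B) ≡ 2 ℕ.* length B
  length-double []      = refl
  length-double (x ∷ B) = trans (cong (2 +_) (length-double B)) (sym (ℕ.*-suc 2 (length B)))

  ∈-double⁻ : ∀ {i} B → i ∈ double B → i ∈ B
  ∈-double⁻ (x ∷ B) (here eq)         = here eq
  ∈-double⁻ (x ∷ B) (there (here eq)) = here eq
  ∈-double⁻ (x ∷ B) (there (there i∈)) = there (∈-double⁻ B i∈)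

  ∈-double⁺ : ∀ {i B} → i ∈ B → i ∈ double B
  ∈-double⁺ (here eq)  = here eq
  ∈-double⁺ (there i∈) = there (there (∈-double⁺ i∈))

  ∈⇒2≤cnt-double : ∀ {i B} → i ∈ B → 2 ≤ cnt i (double B)
  ∈⇒2≤cnt-double {i} {_ ∷ B} (here refl) rewrite cnt-here i (i ∷ double B) | cnt-here i (double B) = s≤s (s≤s z≤n)
  ∈⇒2≤cnt-double {i} {x ∷ B} (there i∈)  = ℕ.≤-trans (∈⇒2≤cnt-double i∈)
    (ℕ.≤-trans (ℕ.m≤n+m (cnt i (double B)) here?) (ℕ.m≤n+m (cnt i (x ∷ double B)) here?))
    where
    here? : ℕ
    here? = if x ≡ᵇ i then 1 else 0

  WeaklyDecreasing StrictlyDecreasing : List ℕ → Set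
  WeaklyDecreasing   w = ∀ {b c} → b ∷ c ∷ [] ⊆ w → c ≤ b
  StrictlyDecreasing w = ∀ {b c} → b ∷ c ∷ [] ⊆ w → c < b

  double-weaklyDecreasing : ∀ B → StrictlyDecreasing B → WeaklyDecreasing (double B)
  double-weaklyDecreasing (x ∷ B) dec (_ ∷ʳ _ ∷ʳ τ)     = double-weaklyDecreasing B (λ σ → dec (x ∷ʳ σ)) τ
  double-weaklyDecreasing (x ∷ B) dec (_ ∷ʳ refl ∷ τ)   = ℕ.<⇒≤ (dec (refl ∷ from∈ (∈-double⁻ B (to∈ τ))))
  double-weaklyDecreasing (x ∷ B) dec (refl ∷ _ ∷ʳ τ)   = ℕ.<⇒≤ (dec (refl ∷ from∈ (∈-double⁻ B (to∈ τ))))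
  double-weaklyDecreasing (x ∷ B) dec (refl ∷ refl ∷ τ) = ℕ.≤-refl

  even-drop : ∀ x w → (∀ i → cnt i (x ∷ x ∷ w) ≡ 0 ⊎ cnt i (x ∷ x ∷ w) ≡ 2) → ∀ i → cnt i w ≡ 0 ⊎ cnt i w ≡ 2
  even-drop x w even i with x ≟ i | even i
  ... | no x≢i   | e = subst (λ k → k ≡ 0 ⊎ k ≡ 2) (trans (cnt-skip (x ∷ w) x≢i) (cnt-skip w x≢i)) e
  ... | yes refl | inj₁ eq with () ← trans (sym (cnt-here x (x ∷ w))) eq
  ... | yes refl | inj₂ eq = inj₁ (ℕ.suc-injective (ℕ.suc-injective
                               (trans (sym (trans (cnt-here x (x ∷ w)) (cong suc (cnt-here x w)))) eq)))

  -- Equal letters of a weakly decreasing word are adjacent: a `y` between two copies of `x` would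
  -- satisfy x ≥ y ≥ x. So the word starts with a pair, and the rest has the same property.
  undouble : ∀ w → WeaklyDecreasing w → (∀ i → cnt i w ≡ 0 ⊎ cnt i w ≡ 2) → ∃ λ B → w ≡ double B
  undouble []      dec even = [] , refl
  undouble (x ∷ []) dec even with even x
  ... | inj₁ eq with () ← trans (sym (cnt-here x [])) eq
  ... | inj₂ eq with () ← trans (sym (cnt-here x [])) eq
  undouble (x ∷ y ∷ w) dec even with x ≟ y
  ... | no x≢y = contradiction x∈w (λ x∈w → x≢y (ℕ.≤-antisym (dec (x ∷ʳ refl ∷ from∈ x∈w)) (dec (refl ∷ refl ∷ minimum w))))
    where
    x∈w : x ∈ w
    x∈w with even x
    ... | inj₁ eq with () ← trans (sym (cnt-here x (y ∷ w))) eq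
    ... | inj₂ eq with u , v , refl , _ ← first-occurrence w
                        (trans (sym (cnt-skip w (x≢y ∘ sym))) (ℕ.suc-injective (trans (sym (cnt-here x (y ∷ w))) eq))) =
      ∈-++⁺ʳ u (here refl)
  ... | yes refl with B , eq ← undouble w (λ τ → dec (x ∷ʳ x ∷ʳ τ)) (even-drop x w even) = x ∷ B , cong (λ v → x ∷ x ∷ v) eq

  -- Inserting and deleting the two smallest letters

  Good : ℕ → ℕ → ℕ → Set
  Good a b c = ¬ (a < b × b < c) × (a ≡ c → a < b)

  -- Avoiding 123 and the Stirling condition both quantify over subsequences of length three. Joined
  -- in this form, they pass to sublists at once.
  TripleGood : List ℕ → Set
  TripleGood w = ∀ {a b c} → a ∷ b ∷ c ∷ [] ⊆ w → Good a b c

  record Valid (n : ℕ) (w : List ℕ) : Set where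
    field
      length≡ : length w ≡ 2 ℕ.* n
      range   : ∀ {i} → i ∈ w → 1 ≤ i × i ≤ n
      twice   : ∀ {i} → 1 ≤ i → i ≤ n → cnt i w ≡ 2
      good    : TripleGood w

  -- A repetition in `B` would put the triple x x x into `double B`, and the Stirling condition
  -- would then require x < x.
  undouble-strict : ∀ B → WeaklyDecreasing (double B) → TripleGood (double B) → StrictlyDecreasing B
  undouble-strict (x ∷ B) dec good (_ ∷ʳ τ)   =
    undouble-strict B (λ σ → dec (x ∷ʳ x ∷ʳ σ)) (λ σ → good (x ∷ʳ x ∷ʳ σ)) τ
  undouble-strict (x ∷ B) dec good {c = c} (refl ∷ τ) = ℕ.≤∧≢⇒< (dec (refl ∷ x ∷ʳ c∈))
    (λ { refl → ℕ.<-irrefl refl (proj₂ (good (refl ∷ refl ∷ c∈)) refl) })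
    where
    c∈ : [ c ] ⊆ double B
    c∈ = from∈ (∈-double⁺ (to∈ τ))

  -- For letters above 1, this is what the 1s in A 1 C 1 D demand: no triple 1 b c may rise, and no
  -- letter may recur across a 1, since the entries between its copies have to exceed it.
  record Insertable (A C D : List ℕ) : Set where
    field
      decreasing : WeaklyDecreasing (C ++ D)
      disjointˡ  : Disjoint A (C ++ D)
      disjointʳ  : Disjoint C D

  Good-suc⁺ : ∀ {a b c} → Good a b c → Good (suc a) (suc b) (suc c)
  Good-suc⁺ (no123 , stirling) = (λ { (s≤s a<b , s≤s b<c) → no123 (a<b , b<c) }) , λ { refl → s≤s (stirling refl) }

  Good-suc⁻ : ∀ {a b c} → Good (suc a) (suc b) (suc c) → Good a b c
  Good-suc⁻ (no123 , stirling) = (λ (a<b , b<c) → no123 (s≤s a<b , s≤s b<c)) , λ { refl → ℕ.≤-pred (stirling refl) }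

  tripleGood-suc⁺ : ∀ w → TripleGood w → TripleGood (map suc w)
  tripleGood-suc⁺ w good τ with _ ∷ _ ∷ _ ∷ [] , σ , refl ← ⊆-map⁻ w τ = Good-suc⁺ (good σ)

  tripleGood-suc⁻ : ∀ w → TripleGood (map suc w) → TripleGood w
  tripleGood-suc⁻ w good τ = Good-suc⁻ (good (map⁺ suc τ))

  module _ {A C D : List ℕ} (2≤ : ∀ {i} → i ∈ A ++ C ++ D → 2 ≤ i) where
    private
      2≤A : ∀ {i} → i ∈ A → 2 ≤ i
      2≤A = 2≤ ∘ ∈-++⁺ˡ
      2≤C : ∀ {i} → i ∈ C → 2 ≤ i
      2≤C = 2≤ ∘ ∈-++⁺ʳ A ∘ ∈-++⁺ˡ
      2≤D : ∀ {i} → i ∈ D → 2 ≤ i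
      2≤D = 2≤ ∘ ∈-++⁺ʳ A ∘ ∈-++⁺ʳ C
      2≤AC : ∀ {i} → i ∈ A ++ C → 2 ≤ i
      2≤AC i∈ = [ 2≤A , 2≤C ]′ (∈-++⁻ A i∈)

      ≮1 : ∀ {i} → 2 ≤ i → ¬ (i < 1)
      ≮1 (s≤s (s≤s _)) (s≤s ())

      ≢1 : ∀ {i} → 2 ≤ i → i ≢ 1
      ≢1 (s≤s ()) refl

      last1 : ∀ {a b} → 2 ≤ a → 2 ≤ b → Good a b 1
      last1 2≤a 2≤b = ≮1 2≤b ∘ proj₂ , λ a≡1 → ⊥-elim (≢1 2≤a a≡1)

      middle1 : ∀ {a c} → 2 ≤ a → a ≢ c → Good a 1 c
      middle1 2≤a a≢c = ≮1 2≤a ∘ proj₁ , λ a≡c → ⊥-elim (a≢c a≡c)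

      first1 : ∀ {b c} → c ≤ b → 2 ≤ c → Good 1 b c
      first1 c≤b 2≤c = (λ (_ , b<c) → ℕ.<⇒≱ b<c c≤b) , λ 1≡c → ⊥-elim (≢1 2≤c (sym 1≡c))

    -- Only triples through a new 1 are in question. As third entry behind larger letters a 1 is
    -- harmless, as middle entry it needs distinct outer letters, and as first entry it needs the
    -- larger letters behind it to decrease. The triples 1 1 c and 1 b 1 are treated separately.
    tripleGood-insert : Insertable A C D → TripleGood (A ++ C ++ D) → TripleGood (A ++ 1 ∷ C ++ 1 ∷ D)
    tripleGood-insert ins good {a} {b} {c} τ with ⊆-insert⁻ A τ
    ... | inj₁ σ with ⊆-insert⁻ (A ++ C) (⊆-trans σ (⊆-reflexive (sym (++-assoc A C (1 ∷ D)))))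
    ...   | inj₁ ρ = good (⊆-trans ρ (⊆-reflexive (++-assoc A C D)))
    ...   | inj₂ ([] , _ , refl , _ , ρ) =
              first1 (Insertable.decreasing ins (++⁺ˡ C ρ)) (2≤D (lookup ρ (there (here refl))))
    ...   | inj₂ (_ ∷ [] , _ , refl , π , ρ) = middle1 (2≤AC (to∈ π))
              (λ { refl → [ (λ a∈A → Insertable.disjointˡ ins (a∈A , ∈-++⁺ʳ C (to∈ ρ)))
                          , (λ a∈C → Insertable.disjointʳ ins (a∈C , to∈ ρ)) ]′ (∈-++⁻ A (to∈ π)) })
    ...   | inj₂ (_ ∷ _ ∷ [] , _ , refl , π , ρ) = last1 (2≤AC (to∈ π)) (2≤AC (lookup π (there (here refl))))
    ...   | inj₂ (_ ∷ _ ∷ _ ∷ [] , _ , () , π , ρ)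
    ...   | inj₂ (_ ∷ _ ∷ _ ∷ _ ∷ _ , _ , () , π , ρ)
    tripleGood-insert ins good {a} {b} {c} τ | inj₂ (_ ∷ _ ∷ _ ∷ [] , _ , () , σ , ρ)
    tripleGood-insert ins good {a} {b} {c} τ | inj₂ (_ ∷ _ ∷ _ ∷ _ ∷ _ , _ , () , σ , ρ)
    tripleGood-insert ins good {a} {b} {c} τ | inj₂ (_ ∷ _ ∷ [] , _ , refl , σ , ρ) =
      last1 (2≤A (to∈ σ)) (2≤A (lookup σ (there (here refl))))
    tripleGood-insert ins good {a} {b} {c} τ | inj₂ (_ ∷ [] , _ , refl , σ , ρ) = middle1 (2≤A (to∈ σ)) a≢c
      where
      a≢c : a ≢ c
      a≢c refl with ∈-++⁻ C (to∈ ρ)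
      ... | inj₁ a∈C         = Insertable.disjointˡ ins (to∈ σ , ∈-++⁺ˡ a∈C)
      ... | inj₂ (here a≡1)  = ≢1 (2≤A (to∈ σ)) a≡1
      ... | inj₂ (there a∈D) = Insertable.disjointˡ ins (to∈ σ , ∈-++⁺ʳ C a∈D)
    tripleGood-insert ins good {a} {b} {c} τ | inj₂ ([] , _ , refl , σ , ρ) with ⊆-insert⁻ C ρ
    ... | inj₁ π = first1 (Insertable.decreasing ins π) (2≤ (∈-++⁺ʳ A (lookup π (there (here refl)))))
    ... | inj₂ ([] , _ , refl , _ , π) = (λ (1<1 , _) → ℕ.<-irrefl refl 1<1) , λ 1≡c → ⊥-elim (≢1 (2≤D (to∈ π)) (sym 1≡c))
    ... | inj₂ (_ ∷ [] , _ , refl , π , _) = (λ (_ , b<1) → ≮1 (2≤C (to∈ π)) b<1) , λ _ → 2≤C (to∈ π)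
    ... | inj₂ (_ ∷ _ ∷ [] , _ , () , _)
    ... | inj₂ (_ ∷ _ ∷ _ ∷ _ , _ , () , _)

    -- Each field of `Insertable` excludes one triple of the longer word: 1 b c with b < c, or i 1 i
    -- across the first or the second 1.
    tripleGood-delete : TripleGood (A ++ 1 ∷ C ++ 1 ∷ D) → TripleGood (A ++ C ++ D) × Insertable A C D
    tripleGood-delete good =
      (λ τ → good (⊆-trans τ (++⁺ (⊆-refl {x = A}) (1 ∷ʳ ⊆-drop-mid C)))) , record
      { decreasing = λ {b} {c} τ → ℕ.≮⇒≥ (λ b<c → proj₁ (good (++⁺ˡ A (refl ∷ ⊆-trans τ (⊆-drop-mid C))))
          (2≤ (∈-++⁺ʳ A (to∈ τ)) , b<c))
      ; disjointˡ  = λ (i∈A , i∈CD) → ≮1 (2≤A i∈A)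
          (proj₂ (good (++⁺ (from∈ i∈A) (refl ∷ ⊆-trans (from∈ i∈CD) (⊆-drop-mid C)))) refl)
      ; disjointʳ  = λ (i∈C , i∈D) → ≮1 (2≤C i∈C)
          (proj₂ (good (++⁺ˡ A (1 ∷ʳ ++⁺ (from∈ i∈C) (refl ∷ from∈ i∈D)))) refl)
      }

  insert : List ℕ → List ℕ → List ℕ → List ℕ
  insert A C D = map suc A ++ 1 ∷ map suc C ++ 1 ∷ map suc D

  -- Length, range and multiplicities are invariant under permutation, so only the triple condition
  -- depends on where the 1s stand.
  insert-↭ : ∀ A C D → insert A C D ↭ 1 ∷ 1 ∷ map suc (A ++ C ++ D)
  insert-↭ A C D = ↭-trans (shift 1 A′ (C′ ++ 1 ∷ D′)) (prep 1 (↭-trans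
    (↭-reflexive (sym (++-assoc A′ C′ (1 ∷ D′)))) (↭-trans (shift 1 (A′ ++ C′) D′) (prep 1 (↭-reflexive (trans
    (++-assoc A′ C′ D′) (sym map-++₃)))))))
    where
    A′ C′ D′ : List ℕ
    A′ = map suc A
    C′ = map suc C
    D′ = map suc D
    map-++₃ : map suc (A ++ C ++ D) ≡ A′ ++ C′ ++ D′
    map-++₃ = trans (map-++ suc A (C ++ D)) (cong (A′ ++_) (map-++ suc C D))

  ∈-map-suc⁻ : ∀ {i w} → suc i ∈ map suc w → i ∈ w
  ∈-map-suc⁻ i∈ with _ , j∈ , refl ← ∈-map⁻ suc i∈ = j∈

  insertable-suc⁺ : ∀ A C D → Insertable A C D → Insertable (map suc A) (map suc C) (map suc D)
  insertable-suc⁺ A C D ins = record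
    { decreasing = λ τ → decreasing′ (⊆-trans τ (⊆-reflexive (sym (map-++ suc C D))))
    ; disjointˡ  = λ (i∈A , i∈CD) → disjoint {A} {C ++ D} (Insertable.disjointˡ ins) (i∈A , subst (_ ∈_) (sym (map-++ suc C D)) i∈CD)
    ; disjointʳ  = disjoint {C} {D} (Insertable.disjointʳ ins)
    }
    where
    decreasing′ : WeaklyDecreasing (map suc (C ++ D))
    decreasing′ τ with _ ∷ _ ∷ [] , σ , refl ← ⊆-map⁻ (C ++ D) τ = s≤s (Insertable.decreasing ins σ)
    disjoint : ∀ {v w} → Disjoint v w → Disjoint (map suc v) (map suc w)
    disjoint v#w (i∈v , i∈w) with _ , j∈v , refl ← ∈-map⁻ suc i∈v = v#w (j∈v , ∈-map-suc⁻ i∈w)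

  insertable-suc⁻ : ∀ A C D → Insertable (map suc A) (map suc C) (map suc D) → Insertable A C D
  insertable-suc⁻ A C D ins = record
    { decreasing = λ τ → ℕ.≤-pred (Insertable.decreasing ins (⊆-trans (map⁺ suc τ) (⊆-reflexive (map-++ suc C D))))
    ; disjointˡ  = λ (i∈A , i∈CD) → Insertable.disjointˡ ins (∈-map⁺ suc i∈A , subst (_ ∈_) (map-++ suc C D) (∈-map⁺ suc i∈CD))
    ; disjointʳ  = λ (i∈C , i∈D) → Insertable.disjointʳ ins (∈-map⁺ suc i∈C , ∈-map⁺ suc i∈D)
    }

  module _ (A C D : List ℕ) {n : ℕ} where
    private
      map-++₃ : map suc A ++ map suc C ++ map suc D ≡ map suc (A ++ C ++ D)
      map-++₃ = sym (trans (map-++ suc A (C ++ D)) (cong (map suc A ++_) (map-++ suc C D)))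

      2≤suc : (∀ {i} → i ∈ A ++ C ++ D → 1 ≤ i) → ∀ {i} → i ∈ map suc A ++ map suc C ++ map suc D → 2 ≤ i
      2≤suc 1≤ i∈ with _ , j∈ , refl ← ∈-map⁻ suc (subst (_ ∈_) map-++₃ i∈) = s≤s (1≤ j∈)

    valid-insert : Valid n (A ++ C ++ D) → Insertable A C D → Valid (suc n) (insert A C D)
    valid-insert valid ins = record
      { length≡ = trans (↭-length (insert-↭ A C D))
                    (trans (cong (2 +_) (trans (length-map suc (A ++ C ++ D)) V.length≡)) (sym (ℕ.*-suc 2 n)))
      ; range   = λ i∈ → range (∈-resp-↭ (insert-↭ A C D) i∈)
      ; twice   = λ 1≤i i≤n → trans (cnt-↭ _ (insert-↭ A C D)) (twice 1≤i i≤n)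
      ; good    = tripleGood-insert (2≤suc (proj₁ ∘ V.range)) (insertable-suc⁺ A C D ins)
                    (subst TripleGood (sym map-++₃) (tripleGood-suc⁺ (A ++ C ++ D) V.good))
      }
      where
      module V = Valid valid
      range : ∀ {i} → i ∈ 1 ∷ 1 ∷ map suc (A ++ C ++ D) → 1 ≤ i × i ≤ suc n
      range (here refl)         = s≤s z≤n , s≤s z≤n
      range (there (here refl)) = s≤s z≤n , s≤s z≤n
      range (there (there i∈))  with _ , j∈ , refl ← ∈-map⁻ suc i∈ = s≤s z≤n , s≤s (proj₂ (V.range j∈))
      twice : ∀ {i} → 1 ≤ i → i ≤ suc n → cnt i (1 ∷ 1 ∷ map suc (A ++ C ++ D)) ≡ 2
      twice {1}           _ _         = cong (2 +_) (∉⇒cnt≡0 (map suc (A ++ C ++ D))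
                                          (λ 1∈ → contradiction (proj₁ (V.range (∈-map-suc⁻ 1∈))) λ ()))
      twice {suc (suc i)} _ (s≤s i≤n) = trans (cnt-map-suc (suc i) (A ++ C ++ D)) (V.twice (s≤s z≤n) i≤n)

    -- Positivity guarantees that the two displayed 1s are the only ones: a letter 0 would be raised
    -- to a further 1.
    valid-delete : (∀ {i} → i ∈ A ++ C ++ D → 1 ≤ i) → Valid (suc n) (insert A C D) →
                   Valid n (A ++ C ++ D) × Insertable A C D
    valid-delete 1≤ valid = record
      { length≡ = trans (sym (length-map suc (A ++ C ++ D))) (ℕ.+-cancelˡ-≡ 2 _ _
                    (trans (sym (↭-length (insert-↭ A C D))) (trans V.length≡ (ℕ.*-suc 2 n))))
      ; range   = λ i∈ → 1≤ i∈ ,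
                    ℕ.≤-pred (proj₂ (V.range (∈-resp-↭ (↭-sym (insert-↭ A C D)) (there (there (∈-map⁺ suc i∈))))))
      ; twice   = twice
      ; good    = tripleGood-suc⁻ (A ++ C ++ D) (subst TripleGood map-++₃ (proj₁ deleted))
      } , insertable-suc⁻ A C D (proj₂ deleted)
      where
      module V = Valid valid
      deleted : TripleGood (map suc A ++ map suc C ++ map suc D) × Insertable (map suc A) (map suc C) (map suc D)
      deleted = tripleGood-delete (2≤suc 1≤) V.good
      twice : ∀ {i} → 1 ≤ i → i ≤ n → cnt i (A ++ C ++ D) ≡ 2
      twice {suc i} _ i≤n = trans (sym (cnt-map-suc (suc i) (A ++ C ++ D)))
        (trans (sym (cnt-↭ (suc (suc i)) (insert-↭ A C D))) (V.twice (s≤s z≤n) (s≤s i≤n)))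

  map-suc⁻ : ∀ w → (∀ {i} → i ∈ w → 2 ≤ i) → ∃ λ v → w ≡ map suc v × (∀ {i} → i ∈ v → 1 ≤ i)
  map-suc⁻ []          2≤ = [] , refl , λ ()
  map-suc⁻ (x ∷ w)     2≤ with 2≤ (here refl) | map-suc⁻ w (2≤ ∘ there)
  ... | s≤s {n = i} 1≤i | v , refl , 1≤ = i ∷ v , refl , λ { (here refl) → 1≤i ; (there i∈) → 1≤ i∈ }

  -- Agreement of the Boolean definition of `Q123` with `Valid`

  allB⁻ : ∀ {A : Set} (P : A → Bool) xs → allB P xs ≡ true → ∀ {x} → x ∈ xs → P x ≡ true
  allB⁻ P (y ∷ xs) eq (here refl) = ∧-conicalˡ (P y) _ eq
  allB⁻ P (y ∷ xs) eq (there x∈)  = allB⁻ P xs (∧-conicalʳ (P y) _ eq) x∈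

  allB⁺ : ∀ {A : Set} (P : A → Bool) xs → (∀ {x} → x ∈ xs → P x ≡ true) → allB P xs ≡ true
  allB⁺ P []       Pxs = refl
  allB⁺ P (y ∷ xs) Pxs = cong₂ _∧_ (Pxs (here refl)) (allB⁺ P xs (Pxs ∘ there))

  pairs⁺ : ∀ {b c} w → b ∷ c ∷ [] ⊆ w → (b , c) ∈ pairs w
  pairs⁺ (x ∷ w) (_ ∷ʳ τ)   = ∈-++⁺ʳ (map (x ,_) w) (pairs⁺ w τ)
  pairs⁺ (x ∷ w) (refl ∷ τ) = ∈-++⁺ˡ (∈-map⁺ (x ,_) (to∈ τ))

  pairs⁻ : ∀ {b c} w → (b , c) ∈ pairs w → b ∷ c ∷ [] ⊆ w
  pairs⁻ (x ∷ w) bc∈ with ∈-++⁻ (map (x ,_) w) bc∈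
  ... | inj₁ bc∈ˡ with _ , c∈ , refl ← ∈-map⁻ (x ,_) bc∈ˡ = refl ∷ from∈ c∈
  ... | inj₂ bc∈ʳ = x ∷ʳ pairs⁻ w bc∈ʳ

  triples⁺ : ∀ {a b c} w → a ∷ b ∷ c ∷ [] ⊆ w → (a , b , c) ∈ triples w
  triples⁺ (x ∷ w) (_ ∷ʳ τ)   = ∈-++⁺ʳ (map _ (pairs w)) (triples⁺ w τ)
  triples⁺ (x ∷ w) (refl ∷ τ) = ∈-++⁺ˡ (∈-map⁺ _ (pairs⁺ w τ))

  triples⁻ : ∀ {a b c} w → (a , b , c) ∈ triples w → a ∷ b ∷ c ∷ [] ⊆ w
  triples⁻ (x ∷ w) abc∈ with ∈-++⁻ (map _ (pairs w)) abc∈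
  ... | inj₁ abc∈ˡ with _ , bc∈ , refl ← ∈-map⁻ _ abc∈ˡ = refl ∷ pairs⁻ w bc∈
  ... | inj₂ abc∈ʳ = x ∷ʳ triples⁻ w abc∈ʳ

  ∈-oneTo⁺ : ∀ {i n} → 1 ≤ i → i ≤ n → i ∈ oneTo n
  ∈-oneTo⁺ {suc i} _ i≤n = ∈-map⁺ suc (∈-upTo⁺ i≤n)

  ∈-oneTo⁻ : ∀ {i n} → i ∈ oneTo n → 1 ≤ i × i ≤ n
  ∈-oneTo⁻ i∈ with _ , j∈ , refl ← ∈-map⁻ suc i∈ = s≤s z≤n , ∈-upTo⁻ j∈

  avoids123⁺ : ∀ w → TripleGood w → avoids123 w ≡ true
  avoids123⁺ w good = allB⁺ _ (triples w) (λ {(a , b , c)} abc∈ → bool a b c (proj₁ (good (triples⁻ w abc∈))))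
    where
    bool : ∀ a b c → ¬ (a < b × b < c) → not ((a <ᵇ b) ∧ (b <ᵇ c)) ≡ true
    bool a b c no123 with a <? b | b <? c
    ... | yes a<b | yes b<c = contradiction (a<b , b<c) no123
    ... | yes a<b | no  b≮c rewrite dec-true (a <? b) a<b | dec-false (b <? c) b≮c = refl
    ... | no  a≮b | _       rewrite dec-false (a <? b) a≮b = refl

  avoids123⁻ : ∀ w → avoids123 w ≡ true → ∀ {a b c} → a ∷ b ∷ c ∷ [] ⊆ w → ¬ (a < b × b < c)
  avoids123⁻ w eq {a} {b} {c} τ (a<b , b<c) with allB⁻ _ (triples w) eq (triples⁺ w τ)
  ... | eq′ rewrite dec-true (a <? b) a<b | dec-true (b <? c) b<c with () ← eq′

  -- The disjunction used in isStirlingCond is local to it, so its predicate is recovered by unification.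
  stirlingPredicate : ∀ w → ∃ λ P → isStirlingCond w ≡ allB P (triples w)
  stirlingPredicate w = _ , refl

  isStirlingCond⁺ : ∀ w → TripleGood w → isStirlingCond w ≡ true
  isStirlingCond⁺ w good = allB⁺ _ (triples w) λ abc∈ → bool (proj₂ (good (triples⁻ w abc∈)))
    where
    bool : ∀ {a b c} → (a ≡ c → a < b) → proj₁ (stirlingPredicate w) (a , b , c) ≡ true
    bool {a} {b} {c} stirling with a ≟ c
    ... | yes a≡c rewrite dec-true (a ≟ c) a≡c = dec-true (a <? b) (stirling a≡c)
    ... | no  a≢c rewrite dec-false (a ≟ c) a≢c = refl

  isStirlingCond⁻ : ∀ w → isStirlingCond w ≡ true → ∀ {a b c} → a ∷ b ∷ c ∷ [] ⊆ w → a ≡ c → a < b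
  isStirlingCond⁻ w eq {a} {b} {c} τ a≡c with allB⁻ _ (triples w) eq (triples⁺ w τ)
  ... | eq′ rewrite dec-true (a ≟ c) a≡c = ℕ.<ᵇ⇒< a b (subst Data.Bool.T (sym eq′) _)

  -- In the form of a Cartesian product, membership and uniqueness of `words` follow from the
  -- general facts about products of lists.
  words-suc : ∀ k n → words (suc k) n ≡ cartesianProductWith _∷_ (oneTo n) (words k n)
  words-suc k n = go (oneTo n)
    where
    go : ∀ xs → concatMap (λ a → map (a ∷_) (words k n)) xs ≡ cartesianProductWith _∷_ xs (words k n)
    go []       = refl
    go (x ∷ xs) = cong (map (x ∷_) (words k n) ++_) (go xs)

  ∈-words⁺ : ∀ n w → (∀ {i} → i ∈ w → 1 ≤ i × i ≤ n) → w ∈ words (length w) n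
  ∈-words⁺ n []      range = here refl
  ∈-words⁺ n (x ∷ w) range with 1≤x , x≤n ← range (here refl) =
    subst (_ ∈_) (sym (words-suc (length w) n))
      (∈-cartesianProductWith⁺ _∷_ (∈-oneTo⁺ 1≤x x≤n) (∈-words⁺ n w (range ∘ there)))

  ∈-words⁻ : ∀ k n {w} → w ∈ words k n → length w ≡ k × (∀ {i} → i ∈ w → 1 ≤ i × i ≤ n)
  ∈-words⁻ zero    n (here refl) = refl , λ ()
  ∈-words⁻ (suc k) n w∈
    with x , v , x∈ , v∈ , refl ← ∈-cartesianProductWith⁻ _∷_ (oneTo n) (words k n) (subst (_ ∈_) (words-suc k n) w∈)
    with eq , range ← ∈-words⁻ k n v∈ =
    cong suc eq , λ { (here refl) → ∈-oneTo⁻ x∈ ; (there i∈) → range i∈ }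

  words-unique : ∀ k n → Unique (words k n)
  words-unique zero    n = All.[] AllPairs.∷ AllPairs.[]
  words-unique (suc k) n = subst Unique (sym (words-suc k n))
    (Unique.cartesianProductWith⁺ _∷_ ∷-injective (Unique.map⁺ ℕ.suc-injective (Unique.upTo⁺ n)) (words-unique k n))

  Q123-unique : ∀ n → Unique (Q123 n)
  Q123-unique n = Unique.filter⁺ _ (words-unique (2 ℕ.* n) n)

  valid⇒∈Q123 : ∀ {n w} → Valid n w → w ∈ Q123 n
  valid⇒∈Q123 {n} {w} valid = ∈-filter⁺ _
    (subst (λ k → w ∈ words k n) length≡ (∈-words⁺ n w range))
    (cong₂ _∧_ (cong₂ _∧_ (cong₂ _∧_ (dec-true (length w ≟ 2 ℕ.* n) length≡) (allB⁺ _ (oneTo n) λ {i} i∈ →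
        dec-true (cnt i w ≟ 2) (twice (proj₁ (∈-oneTo⁻ i∈)) (proj₂ (∈-oneTo⁻ i∈)))))
      (isStirlingCond⁺ w good)) (avoids123⁺ w good))
    where open Valid valid

  ∈Q123⇒valid : ∀ n {w} → w ∈ Q123 n → Valid n w
  ∈Q123⇒valid n {w} w∈ with w∈words , eq ← ∈-filter⁻ _ {xs = words (2 ℕ.* n) n} w∈ = record
    { length≡ = proj₁ (∈-words⁻ (2 ℕ.* n) n w∈words)
    ; range   = proj₂ (∈-words⁻ (2 ℕ.* n) n w∈words)
    ; twice   = λ {i} 1≤i i≤n → ℕ.≡ᵇ⇒≡ (cnt i w) 2 (subst Data.Bool.T (sym (allB⁻ _ (oneTo n)
                  (∧-conicalʳ (length w ≡ᵇ 2 ℕ.* n) _ (∧-conicalˡ (isMultisetPerm n w) _ stirling)) (∈-oneTo⁺ 1≤i i≤n))) _)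
    ; good    = λ τ → avoids123⁻ w (∧-conicalʳ (isStirling n w) _ eq) τ ,
                      isStirlingCond⁻ w (∧-conicalʳ (isMultisetPerm n w) _ stirling) τ
    }
    where
    stirling : isStirling n w ≡ true
    stirling = ∧-conicalˡ (isStirling n w) _ (proj₂ (∈-filter⁻ _ {xs = words (2 ℕ.* n) n} w∈))

  -- Marked words and the insertion of a single 1

  -- A pair (A , B) stands for the word A ++ double B with length B marked letters.

  Marked : Set
  Marked = List ℕ × List ℕ

  -- One copy of the new letter at a time: two applications give A 1 B₁ 1 B₂ with the remaining
  -- letters still marked. This splitting is why the transfer operator factors as T_q T_p.
  insertOne : ℕ → Marked → Marked
  insertOne t (A , B) = A ++ 1 ∷ double (take t B) , drop t B

  shiftUp appendOne : Marked → Marked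
  shiftUp   (A , B) = map suc A , map suc B
  appendOne (A , B) = A , B ++ [ 1 ]

  record IsLevelled (L : ℕ → List Marked) : Set where
    field
      unique     : ∀ m → Unique (L m)
      length≡    : ∀ {m A B} → (A , B) ∈ L m → length B ≡ m
      1<         : ∀ {m A B} → (A , B) ∈ L m → ∀ {i} → i ∈ B → 1 < i
      decreasing : ∀ {m A B} → (A , B) ∈ L m → StrictlyDecreasing B

    1∉ : ∀ {m A B} → (A , B) ∈ L m → 1 ∉ B
    1∉ s∈ 1∈ = ℕ.<-irrefl refl (1< s∈ 1∈)

  ∈-take : ∀ {i : ℕ} t {B} → i ∈ take t B → i ∈ B
  ∈-take t {B} i∈ = subst (_ ∈_) (take++drop≡id t B) (∈-++⁺ˡ i∈)

  ∈-drop : ∀ {i : ℕ} t {B} → i ∈ drop t B → i ∈ B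
  ∈-drop t {B} i∈ = subst (_ ∈_) (take++drop≡id t B) (∈-++⁺ʳ (take t B) i∈)

  -- At the second insertion `A` already contains a 1, so only the last 1 can serve as the
  -- separator.
  split-at-last-one : ∀ A A′ {C C′} → 1 ∉ C → 1 ∉ C′ → A ++ 1 ∷ C ≡ A′ ++ 1 ∷ C′ → A ≡ A′ × C ≡ C′
  split-at-last-one []      []       1∉C 1∉C′ refl = refl , refl
  split-at-last-one []      (_ ∷ A′) 1∉C 1∉C′ refl = contradiction (∈-++⁺ʳ A′ (here refl)) 1∉C
  split-at-last-one (_ ∷ A) []       1∉C 1∉C′ refl = contradiction (∈-++⁺ʳ A (here refl)) 1∉C′
  split-at-last-one (a ∷ A) (_ ∷ A′) 1∉C 1∉C′ eq with refl , eq′ ← ∷-injective eq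
    with refl , refl ← split-at-last-one A A′ 1∉C 1∉C′ eq′ = refl , refl

  -- The letters behind the last 1 are the released ones. Their number gives `t` back, because a
  -- word of level `t + m` has at least `t` marks to release.
  insertOne-injective : ∀ {L m t t′ s s′} → IsLevelled L → s ∈ L (t + m) → s′ ∈ L (t′ + m) →
                        insertOne t s ≡ insertOne t′ s′ → t ≡ t′ × s ≡ s′
  insertOne-injective {L} {m} {t} {t′} {A , B} {A′ , B′} lev s∈ s′∈ eq
    with refl , dB≡ ← split-at-last-one A A′
           (IsLevelled.1∉ lev s∈ ∘ ∈-take t ∘ ∈-double⁻ (take t B))
           (IsLevelled.1∉ lev s′∈ ∘ ∈-take t′ ∘ ∈-double⁻ (take t′ B′)) (cong proj₁ eq) =
    trans (sym (length-take′ s∈)) (trans (cong length take≡) (length-take′ s′∈)) ,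
    cong (A ,_) (trans (sym (take++drop≡id t B)) (trans (cong₂ _++_ take≡ (cong proj₂ eq)) (take++drop≡id t′ B′)))
    where
    open IsLevelled lev
    take≡ : take t B ≡ take t′ B′
    take≡ = double-injective dB≡
    length-take′ : ∀ {t A B} → (A , B) ∈ L (t + m) → length (take t B) ≡ t
    length-take′ {t} {A} {B} AB∈ = trans (length-take t B) (ℕ.m≤n⇒m⊓n≡m (subst (t ≤_) (sym (length≡ AB∈)) (ℕ.m≤m+n t m)))

  unique-map : ∀ {A B : Set} (f : A → B) {xs} → (∀ {x y} → x ∈ xs → y ∈ xs → f x ≡ f y → x ≡ y) →
               Unique xs → Unique (map f xs)
  unique-map f {[]}     inj AllPairs.[] = AllPairs.[]
  unique-map f {x ∷ xs} inj (x∉ AllPairs.∷ xs!) =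
    All.map⁺ (All.tabulate (λ y∈ fx≡fy → All.lookup x∉ y∈ (inj (here refl) (there y∈) fx≡fy)))
    AllPairs.∷ unique-map f (λ x∈ y∈ → inj (there x∈) (there y∈)) xs!

  append-word : ∀ A B → map suc A ++ double (map suc B ++ [ 1 ]) ≡ insert (A ++ double B) [] []
  append-word A B = begin
    map suc A ++ double (map suc B ++ [ 1 ])            ≡⟨ cong (map suc A ++_) (double-++ (map suc B) [ 1 ]) ⟩
    map suc A ++ double (map suc B) ++ 1 ∷ 1 ∷ []       ≡⟨ ++-assoc (map suc A) (double (map suc B)) _ ⟨
    (map suc A ++ double (map suc B)) ++ 1 ∷ 1 ∷ []     ≡⟨ cong (λ w → (map suc A ++ w) ++ _) (double-map suc B) ⟩
    (map suc A ++ map suc (double B)) ++ 1 ∷ 1 ∷ []     ≡⟨ cong (_++ _) (map-++ suc A (double B)) ⟨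
    map suc (A ++ double B) ++ 1 ∷ 1 ∷ []               ∎
    where open ≡-Reasoning

  insert-++-double : ∀ A C D B →
    (map suc A ++ 1 ∷ map suc C ++ 1 ∷ map suc D) ++ double (map suc B) ≡ insert A C (D ++ double B)
  insert-++-double A C D B = begin
    (map suc A ++ 1 ∷ map suc C ++ 1 ∷ map suc D) ++ double (map suc B)
      ≡⟨ ++-assoc (map suc A) _ _ ⟩
    map suc A ++ 1 ∷ (map suc C ++ 1 ∷ map suc D) ++ double (map suc B)
      ≡⟨ cong (λ w → map suc A ++ 1 ∷ w) (++-assoc (map suc C) _ _) ⟩
    map suc A ++ 1 ∷ map suc C ++ 1 ∷ map suc D ++ double (map suc B)
      ≡⟨ cong (λ w → map suc A ++ 1 ∷ map suc C ++ 1 ∷ map suc D ++ w) (double-map suc B) ⟩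
    map suc A ++ 1 ∷ map suc C ++ 1 ∷ map suc D ++ map suc (double B)
      ≡⟨ cong (λ w → map suc A ++ 1 ∷ map suc C ++ 1 ∷ w) (map-++ suc D (double B)) ⟨
    insert A C (D ++ double B) ∎
    where open ≡-Reasoning

  insertOne-twice : ∀ A B C → (map suc A ++ 1 ∷ double (map suc B)) ++ 1 ∷ double (map suc C) ≡
                              insert A (double B) (double C)
  insertOne-twice A B C = trans (++-assoc (map suc A) _ _)
    (cong₂ (λ v w → map suc A ++ 1 ∷ v ++ 1 ∷ w) (double-map suc B) (double-map suc C))

  insert-word : ∀ A B C D →
    ((map suc A ++ 1 ∷ double (map suc B)) ++ 1 ∷ double (map suc C)) ++ double (map suc D) ≡
    insert A (double B) (double C ++ double D)
  insert-word A B C D = trans (cong (_++ double (map suc D)) (insertOne-twice A B C))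
                              (insert-++-double A (double B) (double C) D)

  double-++₃ : ∀ B C D → double (B ++ C ++ D) ≡ double B ++ double C ++ double D
  double-++₃ B C D = trans (double-++ B (C ++ D)) (cong (double B ++_) (double-++ C D))

  -- Validity of marked words under insertion, and its converse

  record Sound (n : ℕ) (s : Marked) : Set where
    field
      valid      : Valid n (proj₁ s ++ double (proj₂ s))
      decreasing : StrictlyDecreasing (proj₂ s)

    positive : ∀ {i} → i ∈ proj₂ s → 1 ≤ i
    positive i∈ = proj₁ (Valid.range valid (∈-++⁺ʳ (proj₁ s) (∈-double⁺ i∈)))

    positiveˡ : ∀ {i} → i ∈ proj₁ s → 1 ≤ i
    positiveˡ i∈ = proj₁ (Valid.range valid (∈-++⁺ˡ i∈))

  strictlyDecreasing-suc : ∀ {B} → StrictlyDecreasing B → StrictlyDecreasing (map suc B)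
  strictlyDecreasing-suc {B} dec τ with _ ∷ _ ∷ [] , σ , refl ← ⊆-map⁻ B τ = s≤s (dec σ)

  sound-append : ∀ {n s} → Sound n s → Sound (suc n) (appendOne (shiftUp s))
  sound-append {n} {A , B} sound = record
    { valid      = subst (Valid (suc n)) (sym (append-word A B)) (valid-insert (A ++ double B) [] []
                     (subst (Valid n) (sym (++-identityʳ (A ++ double B))) valid) (record
                     { decreasing = λ () ; disjointˡ = λ () ; disjointʳ = λ () }))
    ; decreasing = dec
    }
    where
    open Sound sound
    dec : StrictlyDecreasing (map suc B ++ [ 1 ])
    dec τ with ⊆-insert⁻ (map suc B) τ
    ... | inj₁ σ = strictlyDecreasing-suc decreasing (⊆-trans σ (⊆-reflexive (++-identityʳ (map suc B))))
    ... | inj₂ ([] , _ , refl , _ , ())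
    ... | inj₂ (_ ∷ [] , _ , refl , σ , _) with _ , b∈ , refl ← ∈-map⁻ suc (to∈ σ) = s≤s (positive b∈)
    ... | inj₂ (_ ∷ _ ∷ [] , _ , () , _)
    ... | inj₂ (_ ∷ _ ∷ _ ∷ _ , _ , () , _)

  sound-insert : ∀ {n A} B C D → Sound n (A , B ++ C ++ D) →
    Sound (suc n) ((map suc A ++ 1 ∷ double (map suc B)) ++ 1 ∷ double (map suc C) , map suc D)
  sound-insert {n} {A} B C D sound = record
    { valid      = subst (Valid (suc n)) (sym (insert-word A B C D))
                     (valid-insert A (double B) (double C ++ double D)
                       (subst (λ w → Valid n (A ++ w)) (double-++₃ B C D) valid) record
                       { decreasing = λ τ → double-weaklyDecreasing (B ++ C ++ D) decreasing
                                              (⊆-trans τ (⊆-reflexive (sym (double-++₃ B C D))))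
                       ; disjointˡ  = λ (i∈A , i∈) → disjointˡ i∈A (∈-double⁻ (B ++ C ++ D) (subst (_ ∈_) (sym (double-++₃ B C D)) i∈))
                       ; disjointʳ  = λ (i∈B , i∈) → ℕ.<-irrefl refl (decreasing
                           (++⁺ (from∈ (∈-double⁻ B i∈B)) (from∈ (∈-double⁻ (C ++ D) (subst (_ ∈_) (sym (double-++ C D)) i∈)))))
                       })
    ; decreasing = strictlyDecreasing-suc (λ τ → decreasing (++⁺ˡ B (++⁺ˡ C τ)))
    }
    where
    open Sound sound
    -- A marked letter has both its occurrences in the doubled part, so one in `A` would be a third.
    disjointˡ : ∀ {i} → i ∈ A → i ∈ B ++ C ++ D → ⊥
    disjointˡ {i} i∈A i∈ = ∈⇒cnt≢0 i∈A (ℕ.n≤0⇒n≡0 (ℕ.+-cancelʳ-≤ 2 _ 0 (ℕ.≤-trans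
      (ℕ.+-monoʳ-≤ (cnt i A) (∈⇒2≤cnt-double i∈)) (ℕ.≤-reflexive (trans (sym (cnt-++ i A (double (B ++ C ++ D))))
      (Valid.twice valid (positive i∈) (proj₂ (Valid.range valid (∈-++⁺ˡ i∈A)))))))))

  -- This is why releasing at most `N` letters at a time loses no word of order up to `N`.
  marks≤ : ∀ {n} A B → Valid n (A ++ double B) → length B ≤ n
  marks≤ A B valid = ℕ.*-cancelˡ-≤ 2 (ℕ.≤-trans (ℕ.m≤n+m (2 ℕ.* length B) (length A)) (ℕ.≤-reflexive
    (trans (cong (length A +_) (sym (length-double B))) (trans (sym (length-++ A)) (Valid.length≡ valid)))))

  -- Every letter occurs twice, and disjointness keeps both copies on the same side of each 1. Hence
  -- multiplicities in `C` and in `D` are 0 or 2, and a weakly decreasing word of this kind consists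
  -- of doubled letters.
  decompose : ∀ {n} A C D B → Valid n (A ++ C ++ (D ++ double B)) → Insertable A C (D ++ double B) →
              ∃₂ λ B₁ B₂ → C ≡ double B₁ × D ≡ double B₂ × StrictlyDecreasing (B₁ ++ B₂ ++ B)
  decompose {n} A C D B valid ins = let
      B₁ , C≡ = undouble C (λ τ → decreasing (++⁺ʳ (D ++ double B) τ)) evenC
      B₂ , D≡ = undouble D (λ τ → decreasing (++⁺ˡ C (++⁺ʳ (double B) τ))) evenD
      word≡   = trans (double-++₃ B₁ B₂ B) (cong₂ (λ v w → v ++ w ++ double B) (sym C≡) (sym D≡))
    in B₁ , B₂ , C≡ , D≡ , undouble-strict (B₁ ++ B₂ ++ B)
         (subst WeaklyDecreasing (sym word≡) decreasing)
         (subst TripleGood (sym word≡) (λ τ → Valid.good valid (++⁺ˡ A τ)))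
    where
    open Insertable ins
    total : ∀ {i} → i ∈ C ++ (D ++ double B) → cnt i A + (cnt i C + (cnt i D + cnt i (double B))) ≡ 2
    total {i} i∈ = trans (sym (trans (cnt-++ i A _) (cong (cnt i A +_) (trans (cnt-++ i C _) (cong (cnt i C +_) (cnt-++ i D (double B)))))))
      (Valid.twice valid (proj₁ (Valid.range valid (∈-++⁺ʳ A i∈))) (proj₂ (Valid.range valid (∈-++⁺ʳ A i∈))))
    evenC : ∀ i → cnt i C ≡ 0 ⊎ cnt i C ≡ 2
    evenC i with i ∈? C
    ... | no  i∉C = inj₁ (∉⇒cnt≡0 C i∉C)
    ... | yes i∈C with total (∈-++⁺ˡ i∈C)
    ...   | eq rewrite ∉⇒cnt≡0 A (λ i∈A → disjointˡ (i∈A , ∈-++⁺ˡ i∈C))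
                     | ∉⇒cnt≡0 D (λ i∈D → disjointʳ (i∈C , ∈-++⁺ˡ i∈D))
                     | ∉⇒cnt≡0 (double B) (λ i∈B → disjointʳ (i∈C , ∈-++⁺ʳ D i∈B))
                     | ℕ.+-identityʳ (cnt i C) = inj₂ eq
    evenD : ∀ i → cnt i D ≡ 0 ⊎ cnt i D ≡ 2
    evenD i with i ∈? D
    ... | no  i∉D = inj₁ (∉⇒cnt≡0 D i∉D)
    ... | yes i∈D with total (∈-++⁺ʳ C (∈-++⁺ˡ i∈D))
    ...   | eq rewrite ∉⇒cnt≡0 A (λ i∈A → disjointˡ (i∈A , ∈-++⁺ʳ C (∈-++⁺ˡ i∈D)))
                     | ∉⇒cnt≡0 C (λ i∈C → disjointʳ (i∈C , ∈-++⁺ˡ i∈D)) with i ∈? B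
    ...     | no  i∉B = inj₂ (trans (sym (trans (cong (cnt i D +_) (∉⇒cnt≡0 (double B) (i∉B ∘ ∈-double⁻ B))) (ℕ.+-identityʳ _))) eq)
    -- `double B` already holds both occurrences of `i`, which leaves none for `D`.
    ...     | yes i∈B = inj₁ (ℕ.n≤0⇒n≡0 (ℕ.+-cancelʳ-≤ 2 _ 0
                          (ℕ.≤-trans (ℕ.+-monoʳ-≤ (cnt i D) (∈⇒2≤cnt-double i∈B)) (ℕ.≤-reflexive eq))))

  data LastOne (B : List ℕ) : Set where
    ends-with-one : ∀ B₀ → B ≡ B₀ ++ [ 1 ] → 1 ∉ B₀ → LastOne B
    without-one   : 1 ∉ B → LastOne B

  -- A strictly decreasing list of positive letters can contain 1 only at its end. The two outcomes
  -- separate the appended words from the inserted ones.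
  lastOne : ∀ B → StrictlyDecreasing B → (∀ {i} → i ∈ B → 1 ≤ i) → LastOne B
  lastOne B dec 1≤ with initLast B
  ... | []       = without-one λ ()
  ... | B₀ ∷ʳ′ x = go x (1≤ (∈-++⁺ʳ B₀ (here refl))) (λ 1∈B₀ → dec (++⁺ (from∈ 1∈B₀) ⊆-refl))
    where
    go : ∀ x → 1 ≤ x → (1 ∈ B₀ → x < 1) → LastOne (B₀ ++ [ x ])
    go 1             1≤x x<1 = ends-with-one B₀ refl (λ 1∈ → ℕ.<⇒≱ (x<1 1∈) 1≤x)
    go (suc (suc x)) 1≤x x<1 = without-one λ 1∈ → [ (λ 1∈B₀ → ℕ.<⇒≱ (x<1 1∈B₀) 1≤x) , (λ { (here ()) ; (there ()) }) ]′ (∈-++⁻ B₀ 1∈)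

  ∈-oneless : ∀ {w} → 1 ∉ w → (∀ {i} → i ∈ w → 1 ≤ i) → ∀ {i} → i ∈ w → 2 ≤ i
  ∈-oneless 1∉w 1≤ {i} i∈ = ℕ.≤∧≢⇒< (1≤ i∈) (λ { refl → 1∉w i∈ })

  -- Enumeration of marked words by level

  module Enumeration (N : ℕ) where

    insertionsAt : (ℕ → List Marked) → ℕ → ℕ → List Marked
    insertionsAt L m t = map (insertOne t) (L (t + m))

    -- The `suc N` values of `t` are t = 0, which gives the term c A_m of T_c, and the `N` positive
    -- values of the cut-off sum.
    insertions : (ℕ → List Marked) → ℕ → List Marked
    insertions L m = concat (applyUpTo (insertionsAt L m) (suc N))

    -- For `n ≤ N`, `marked n m` lists each valid word of order `n` with `m` marks exactly once. The
    -- new letter is either itself marked, and is then the last mark, or both its copies lie in the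
    -- unmarked part.
    marked appended : ℕ → ℕ → List Marked
    shifted : ℕ → ℕ → List Marked
    shifted n m = map shiftUp (marked n m)

    marked zero    zero    = [ [] , [] ]
    marked zero    (suc m) = []
    marked (suc n) m       = appended n m ++ insertions (insertions (shifted n)) m

    appended n zero    = []
    appended n (suc m) = map appendOne (shifted n m)

    insertions⁺ : ∀ L A B C → length B ≤ N → (A , B ++ C) ∈ L (length B + length C) →
                  (A ++ 1 ∷ double B , C) ∈ insertions L (length C)
    insertions⁺ L A B C B≤N AB∈ = ∈-concat⁺′
      (subst (_∈ map (insertOne (length B)) (L (length B + length C)))
        (cong₂ (λ B C → A ++ 1 ∷ double B , C) (take-length B C) (drop-length B C)) (∈-map⁺ (insertOne (length B)) AB∈))
      (∈-applyUpTo⁺ (insertionsAt L (length C)) (s≤s B≤N))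
      where
      take-length : ∀ (B C : List ℕ) → take (length B) (B ++ C) ≡ B
      take-length []      C = refl
      take-length (x ∷ B) C = cong (x ∷_) (take-length B C)
      drop-length : ∀ (B C : List ℕ) → drop (length B) (B ++ C) ≡ C
      drop-length []      C = refl
      drop-length (x ∷ B) C = drop-length B C

    insertions⁻ : ∀ L {m x} → x ∈ insertions L m → ∃₂ λ t s → s ∈ L (t + m) × x ≡ insertOne t s
    insertions⁻ L {m} x∈ with _ , x∈′ , xs∈ ← ∈-concat⁻′ (applyUpTo (insertionsAt L m) (suc N)) x∈
      with t , _ , refl ← ∈-applyUpTo⁻ (insertionsAt L m) xs∈
      with s , s∈ , refl ← ∈-map⁻ (insertOne t) x∈′ = t , s , s∈ , refl

    insertions-levelled : ∀ {L} → IsLevelled L → IsLevelled (insertions L)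
    insertions-levelled {L} lev = record
      { unique     = λ m → Unique.concat⁺
          (All.applyUpTo⁺₂ (insertionsAt L m) (suc N) λ t → unique-map (insertOne t)
            (λ x∈ y∈ eq → proj₂ (insertOne-injective {t = t} {t′ = t} lev x∈ y∈ eq)) (unique (t + m)))
          (AllPairs.applyUpTo⁺₁ (insertionsAt L m) (suc N) λ {t} {t′} t<t′ _ (x∈ , x∈′) →
            disjoint t<t′ (∈-map⁻ (insertOne t) x∈) (∈-map⁻ (insertOne t′) x∈′))
      ; length≡    = λ x∈ → length≡′ (insertions⁻ L x∈)
      ; 1<         = λ x∈ → 1<′ (insertions⁻ L x∈)
      ; decreasing = λ x∈ → decreasing′ (insertions⁻ L x∈)
      }
      where
      open IsLevelled lev
      disjoint : ∀ {m t t′ x} → t < t′ → (∃ λ s → s ∈ L (t + m) × x ≡ insertOne t s) →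
                 (∃ λ s → s ∈ L (t′ + m) × x ≡ insertOne t′ s) → ⊥
      disjoint t<t′ (s , s∈ , refl) (s′ , s′∈ , eq) = ℕ.<⇒≢ t<t′ (proj₁ (insertOne-injective lev s∈ s′∈ eq))
      length≡′ : ∀ {m A B} → (∃₂ λ t s → s ∈ L (t + m) × (A , B) ≡ insertOne t s) → length B ≡ m
      length≡′ {m} (t , (A , B) , s∈ , refl) = trans (length-drop t B) (trans (cong (ℕ._∸ t) (length≡ s∈)) (ℕ.m+n∸m≡n t m))
      1<′ : ∀ {m A B} → (∃₂ λ t s → s ∈ L (t + m) × (A , B) ≡ insertOne t s) → ∀ {i} → i ∈ B → 1 < i
      1<′ (t , _ , s∈ , refl) i∈ = 1< s∈ (∈-drop t i∈)
      decreasing′ : ∀ {m A B} → (∃₂ λ t s → s ∈ L (t + m) × (A , B) ≡ insertOne t s) → StrictlyDecreasing B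
      decreasing′ (t , (A , B) , s∈ , refl) τ =
        decreasing s∈ (⊆-trans (++⁺ˡ (take t B) τ) (⊆-reflexive (take++drop≡id t B)))

    InsertedFrom : ℕ → Marked → Set
    InsertedFrom n x = ∃ λ A → ∃ λ B → ∃₂ λ C D → (∃ λ k → (A , B ++ C ++ D) ∈ marked n k) ×
      x ≡ ((map suc A ++ 1 ∷ double (map suc B)) ++ 1 ∷ double (map suc C) , map suc D)

    insertedFrom : ∀ n m {x} → x ∈ insertions (insertions (shifted n)) m → InsertedFrom n x
    insertedFrom n m x∈
      with t′ , _ , x∈₁ , refl ← insertions⁻ (insertions (shifted n)) x∈
      with t , _ , x∈₂ , refl ← insertions⁻ (shifted n) x∈₁
      with (A , B) , AB∈ , refl ← ∈-map⁻ shiftUp x∈₂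
      = A , take t B , take t′ (drop t B) , drop t′ (drop t B) , (_ , subst (λ B → (A , B) ∈ _) B≡ AB∈) ,
        cong₂ _,_ (cong₂ (λ v w → (map suc A ++ 1 ∷ double v) ++ 1 ∷ double w) (take-map t B)
                    (trans (cong (take t′) (drop-map t B)) (take-map t′ (drop t B))))
                  (trans (cong (drop t′) (drop-map t B)) (drop-map t′ (drop t B)))
        where
        B≡ : B ≡ take t B ++ take t′ (drop t B) ++ drop t′ (drop t B)
        B≡ = sym (trans (cong (take t B ++_) (take++drop≡id t′ (drop t B))) (take++drop≡id t B))

    sound : ∀ n m {s} → s ∈ marked n m → Sound n s
    sound-inserted : ∀ n m {s} → s ∈ insertions (insertions (shifted n)) m → Sound (suc n) s

    sound zero    zero    (here refl) = record
      { valid = record { length≡ = refl ; range = λ () ; twice = λ { (s≤s _) () } ; good = λ () } ; decreasing = λ () }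
    sound (suc n) zero    s∈ = sound-inserted n zero s∈
    sound (suc n) (suc m) s∈ with ∈-++⁻ (appended n (suc m)) s∈
    ... | inj₂ s∈ʳ = sound-inserted n (suc m) s∈ʳ
    ... | inj₁ s∈ˡ with _ , s∈₁ , refl ← ∈-map⁻ appendOne s∈ˡ with _ , s∈₂ , refl ← ∈-map⁻ shiftUp s∈₁ =
      sound-append (sound n m s∈₂)

    sound-inserted n m s∈ with A , B , C , D , (k , s∈₁) , refl ← insertedFrom n m s∈ =
      sound-insert B C D (sound n k s∈₁)

    length-marked : ∀ n m {s} → s ∈ marked n m → length (proj₂ s) ≡ m
    -- Raising makes all marked letters exceed 1, so the newly placed 1 can be recognised; this
    -- keeps the two insertions injective.
    shifted-levelled : ∀ n → IsLevelled (shifted n)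
    marked-unique : ∀ n m → Unique (marked n m)

    length-marked zero    zero    (here refl) = refl
    length-marked (suc n) m s∈ with ∈-++⁻ (appended n m) s∈
    ... | inj₂ s∈ʳ = IsLevelled.length≡ (insertions-levelled (insertions-levelled (shifted-levelled n))) s∈ʳ
    length-marked (suc n) (suc m) s∈ | inj₁ s∈ˡ
      with (A , B) , s∈₁ , refl ← ∈-map⁻ appendOne s∈ˡ =
      trans (length-++ B) (trans (ℕ.+-comm (length B) 1) (cong suc (IsLevelled.length≡ (shifted-levelled n) s∈₁)))

    shifted-levelled n = record
      { unique     = λ m → Unique.map⁺ shiftUp-injective (marked-unique n m)
      ; length≡    = λ {m} s∈ → length≡ m (∈-map⁻ shiftUp s∈)
      ; 1<         = λ {m} s∈ → 1< m (∈-map⁻ shiftUp s∈)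
      ; decreasing = λ {m} s∈ → decreasing m (∈-map⁻ shiftUp s∈)
      }
      where
      shiftUp-injective : ∀ {s s′} → shiftUp s ≡ shiftUp s′ → s ≡ s′
      shiftUp-injective eq = cong₂ _,_ (map-injective ℕ.suc-injective (cong proj₁ eq))
                                       (map-injective ℕ.suc-injective (cong proj₂ eq))
      length≡ : ∀ m {A B} → (∃ λ s → s ∈ marked n m × (A , B) ≡ shiftUp s) → length B ≡ m
      length≡ m ((_ , B) , s∈ , refl) = trans (length-map suc B) (length-marked n m s∈)
      1< : ∀ m {A B} → (∃ λ s → s ∈ marked n m × (A , B) ≡ shiftUp s) → ∀ {i} → i ∈ B → 1 < i
      1< m (s , s∈ , refl) i∈ with _ , j∈ , refl ← ∈-map⁻ suc i∈ = s≤s (Sound.positive (sound n m s∈) j∈)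
      decreasing : ∀ m {A B} → (∃ λ s → s ∈ marked n m × (A , B) ≡ shiftUp s) → StrictlyDecreasing B
      decreasing m (s , s∈ , refl) = strictlyDecreasing-suc (Sound.decreasing (sound n m s∈))

    marked-unique zero    zero    = All.[] AllPairs.∷ AllPairs.[]
    marked-unique zero    (suc m) = AllPairs.[]
    marked-unique (suc n) zero    = IsLevelled.unique (insertions-levelled (insertions-levelled (shifted-levelled n))) zero
    marked-unique (suc n) (suc m) = Unique.++⁺
      (Unique.map⁺ (λ {s} {s′} eq → cong₂ _,_ (cong proj₁ eq) (proj₁ (∷ʳ-injective (proj₂ s) (proj₂ s′) (cong proj₂ eq))))
        (IsLevelled.unique (shifted-levelled n) m))
      (IsLevelled.unique inserted (suc m))
      (λ (s∈ˡ , s∈ʳ) → disjoint (∈-map⁻ appendOne s∈ˡ) s∈ʳ)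
      where
      inserted : IsLevelled (insertions (insertions (shifted n)))
      inserted = insertions-levelled (insertions-levelled (shifted-levelled n))
      -- An appended word has a marked 1, an inserted word has none.
      disjoint : ∀ {s} → (∃ λ s′ → s′ ∈ shifted n m × s ≡ appendOne s′) → s ∈ insertions (insertions (shifted n)) (suc m) → ⊥
      disjoint ((_ , B) , _ , refl) s∈ = IsLevelled.1∉ inserted s∈ (∈-++⁺ʳ B (here refl))

    -- The construction is inverted by removing the 1s, whose place tells which clause produced the
    -- word. The bound on `n` keeps both released blocks within the cutoff.
    complete : ∀ n A B → n ≤ N → Valid n (A ++ double B) → StrictlyDecreasing B → (A , B) ∈ marked n (length B)
    complete zero    []      []      n≤N valid dec = here refl
    complete zero    []      (x ∷ B) n≤N valid dec with () ← Valid.length≡ valid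
    complete zero    (x ∷ A) B       n≤N valid dec with () ← Valid.length≡ valid
    complete (suc n) A′ B′ n<N valid dec = cases (lastOne B′ dec (λ i∈ → 1≤ (∈-++⁺ʳ A′ (∈-double⁺ i∈))))
      where
      1≤ : ∀ {i} → i ∈ A′ ++ double B′ → 1 ≤ i
      1≤ = proj₁ ∘ Valid.range valid
      count : cnt 1 A′ + cnt 1 (double B′) ≡ 2
      count = trans (sym (cnt-++ 1 A′ (double B′))) (Valid.twice valid ℕ.≤-refl (s≤s z≤n))
      n≤N : n ≤ N
      n≤N = ℕ.<⇒≤ n<N

      cases : LastOne B′ → (A′ , B′) ∈ marked (suc n) (length B′)
      -- The marked 1 stands for both copies, so `A′` contains none.
      cases (ends-with-one B₀ refl 1∉B₀)
        with A , refl , 1≤A ← map-suc⁻ A′ (∈-oneless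
               (λ 1∈A′ → ∈⇒cnt≢0 1∈A′ (ℕ.n≤0⇒n≡0 (ℕ.+-cancelʳ-≤ 2 _ 0 (ℕ.≤-trans
                 (ℕ.+-monoʳ-≤ (cnt 1 A′) (∈⇒2≤cnt-double {B = B₀ ++ [ 1 ]} (∈-++⁺ʳ B₀ (here refl)))) (ℕ.≤-reflexive count)))))
               (1≤ ∘ ∈-++⁺ˡ))
        with B , refl , 1≤B ← map-suc⁻ B₀ (∈-oneless 1∉B₀ (λ i∈ → 1≤ (∈-++⁺ʳ A′ (∈-double⁺ (∈-++⁺ˡ i∈)))))
        = subst ((map suc A , map suc B ++ [ 1 ]) ∈_) (cong (marked (suc n)) (sym length-B′))
            (∈-++⁺ˡ (∈-map⁺ appendOne (∈-map⁺ shiftUp (complete n A B n≤N valid′ dec′))))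
        where
        length-B′ : length (map suc B ++ [ 1 ]) ≡ suc (length B)
        length-B′ = trans (length-++ (map suc B)) (trans (ℕ.+-comm _ 1) (cong suc (length-map suc B)))
        valid′ : Valid n (A ++ double B)
        valid′ = subst (Valid n) (++-identityʳ (A ++ double B)) (proj₁ (valid-delete (A ++ double B) [] []
          (λ i∈ → [ 1≤A , 1≤B ∘ ∈-double⁻ B ]′ (∈-++⁻ A (subst (_ ∈_) (++-identityʳ (A ++ double B)) i∈)))
          (subst (Valid (suc n)) (append-word A B) valid)))
        dec′ : StrictlyDecreasing B
        dec′ τ = ℕ.≤-pred (dec (++⁺ʳ [ 1 ] (map⁺ suc τ)))
      -- Both copies of 1 lie in `A′`; two uses of `first-occurrence` cut `A′` at them.
      cases (without-one 1∉B′)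
        with A₁ , w , refl , 1∉A₁ , eq ← first-occurrence A′ (trans (sym (trans (cong (cnt 1 A′ +_)
               (∉⇒cnt≡0 (double B′) (1∉B′ ∘ ∈-double⁻ B′))) (ℕ.+-identityʳ _))) count)
        with C₁ , D₁ , refl , 1∉C₁ , eq′ ← first-occurrence w eq
        with A , refl , 1≤A ← map-suc⁻ A₁ (∈-oneless 1∉A₁ (λ i∈ → 1≤ (∈-++⁺ˡ (∈-++⁺ˡ i∈))))
        with C , refl , 1≤C ← map-suc⁻ C₁ (∈-oneless 1∉C₁ (λ i∈ → 1≤ (∈-++⁺ˡ (∈-++⁺ʳ (map suc A) (there (∈-++⁺ˡ i∈))))))
        with D , refl , 1≤D ← map-suc⁻ D₁ (∈-oneless (λ 1∈D₁ → ∈⇒cnt≢0 1∈D₁ eq′)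
               (λ i∈ → 1≤ (∈-++⁺ˡ (∈-++⁺ʳ (map suc A) (there (∈-++⁺ʳ (map suc C) (there i∈)))))))
        with B , refl , 1≤B ← map-suc⁻ B′ (∈-oneless 1∉B′ (λ i∈ → 1≤ (∈-++⁺ʳ A′ (∈-double⁺ i∈))))
        with valid₀ , ins ← valid-delete A C (D ++ double B)
               (λ i∈ → [ 1≤A , (λ i∈ → [ 1≤C , (λ i∈ → [ 1≤D , 1≤B ∘ ∈-double⁻ B ]′ (∈-++⁻ D i∈)) ]′ (∈-++⁻ C i∈)) ]′ (∈-++⁻ A i∈))
               (subst (Valid (suc n)) (insert-++-double A C D B) valid)
        with B₁ , B₂ , refl , refl , dec₀ ← decompose A C D B valid₀ ins
        = ∈-++⁺ʳ (appended n (length (map suc B))) (subst (_∈ insertions (insertions (shifted n)) (length (map suc B)))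
            (cong (_, map suc B) (insertOne-twice A B₁ B₂))
            (insertions⁺ (insertions (shifted n)) (map suc A ++ 1 ∷ double (map suc B₁)) (map suc B₂) (map suc B)
              (bound B₂ (ℕ.≤-trans (ℕ.m≤m+n _ _) (ℕ.≤-trans (ℕ.≤-reflexive (sym (length-++ B₂)))
                (ℕ.≤-trans (ℕ.m≤n+m _ _) (ℕ.≤-reflexive (sym (length-++ B₁)))))))
              (subst (λ k → (map suc A ++ 1 ∷ double (map suc B₁) , map suc B₂ ++ map suc B) ∈ insertions (shifted n) k)
                (length-++ (map suc B₂))
                (insertions⁺ (shifted n) (map suc A) (map suc B₁) (map suc B₂ ++ map suc B)
                  (bound B₁ (ℕ.≤-trans (ℕ.m≤m+n _ _) (ℕ.≤-reflexive (sym (length-++ B₁)))))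
                  (subst₂ (λ B k → (map suc A , B) ∈ shifted n k) map≡ length≡
                    (∈-map⁺ shiftUp (complete n A (B₁ ++ B₂ ++ B) n≤N valid₁ dec₀)))))))
        where
        valid₁ : Valid n (A ++ double (B₁ ++ B₂ ++ B))
        valid₁ = subst (λ w → Valid n (A ++ w)) (sym (double-++₃ B₁ B₂ B)) valid₀
        bound : ∀ F → length F ≤ length (B₁ ++ B₂ ++ B) → length (map suc F) ≤ N
        bound F F≤ = ℕ.≤-trans (ℕ.≤-reflexive (length-map suc F)) (ℕ.≤-trans F≤ (ℕ.≤-trans (marks≤ A _ valid₁) n≤N))
        map≡ : map suc (B₁ ++ B₂ ++ B) ≡ map suc B₁ ++ map suc B₂ ++ map suc B
        map≡ = trans (map-++ suc B₁ (B₂ ++ B)) (cong (map suc B₁ ++_) (map-++ suc B₂ B))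
        length≡ : length (B₁ ++ B₂ ++ B) ≡ length (map suc B₁) + length (map suc B₂ ++ map suc B)
        length≡ = trans (sym (length-map suc (B₁ ++ B₂ ++ B))) (trans (cong length map≡) (length-++ (map suc B₁)))

    -- The two lists are ordered differently, but both are free of repetitions and have the same
    -- members. A permutation is enough for comparing sums.
    Q123↭marked : ∀ n → n ≤ N → map (_, []) (Q123 n) ↭ marked n 0
    Q123↭marked n n≤N = ∼bag⇒↭ (unique∧set⇒bag
      (Unique.map⁺ (cong proj₁) (Q123-unique n)) (marked-unique n 0) (mk⇔ to from))
      where
      to : ∀ {s} → s ∈ map (_, []) (Q123 n) → s ∈ marked n 0
      to s∈ with w , w∈ , refl ← ∈-map⁻ (_, []) s∈ =
        complete n w [] n≤N (subst (Valid n) (sym (++-identityʳ w)) (∈Q123⇒valid n w∈)) (λ ())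
      from : ∀ {s} → s ∈ marked n 0 → s ∈ map (_, []) (Q123 n)
      from {w , B} s∈ with B | length-marked n 0 s∈ | Sound.valid (sound n 0 s∈)
      ... | [] | _ | valid = ∈-map⁺ (_, []) (valid⇒∈Q123 (subst (Valid n) (++-identityʳ w) valid))

-- A polynomial solver with integer coefficients over any commutative ring

-- The coefficients are formal differences (a , b) = a - b of natural numbers, kept in the normal
-- form where a or b is zero because the solver compares evaluated coefficients definitionally.
module DifferenceSolver {c ℓ : Level} (R : CommutativeRing c ℓ) where
  open CommutativeRing R hiding (zero)
  open AbelianGroupProperties +-abelianGroup using (⁻¹-∙-comm; ⁻¹-anti-homo‿-; ε⁻¹≈ε)
  open CommutativeSemigroupProperties +-commutativeSemigroup using (interchange)
  open RingProperties ring using (-‿distribˡ-*; -‿distribʳ-*)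
  open SemiringMult semiring using (×-homo-+; ×1-homo-*; ×-homo-1) renaming (_×_ to _×′_)
  open SetoidReasoning setoid

  private
    reduce : ℕ → ℕ → ℕ × ℕ
    reduce a       zero    = a , 0
    reduce zero    (suc b) = 0 , suc b
    reduce (suc a) (suc b) = reduce a b

  differences : RawRing _ _
  differences = record
    { Carrier = ℕ × ℕ
    ; _≈_     = _≡_
    ; _+_     = λ (a , b) (c , d) → reduce (a ℕ.+ c) (b ℕ.+ d)
    ; _*_     = λ (a , b) (c , d) → reduce (a ℕ.* c ℕ.+ b ℕ.* d) (a ℕ.* d ℕ.+ b ℕ.* c)
    ; -_      = λ (a , b) → b , a
    ; 0#      = 0 , 0
    ; 1#      = 1 , 0
    }

  private
    ι : ℕ → Carrier
    ι a = a ×′ 1#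

    -- The special case lets the solver's constant 1 denote 1# itself.
    ⟦_⟧ : ℕ × ℕ → Carrier
    ⟦ 1 , 0 ⟧ = 1#
    ⟦ a , b ⟧ = ι a - ι b

    ⟦⟧≈ : ∀ a b → ⟦ a , b ⟧ ≈ ι a - ι b
    ⟦⟧≈ 0             b       = refl
    ⟦⟧≈ 1             0       = sym (trans (+-cong (×-homo-1 1#) ε⁻¹≈ε) (+-identityʳ 1#))
    ⟦⟧≈ 1             (suc b) = refl
    ⟦⟧≈ (suc (suc a)) b       = refl

    medial : ∀ a b c d → (a + b) - (c + d) ≈ (a - c) + (b - d)
    medial a b c d = trans (+-congˡ (sym (⁻¹-∙-comm c d))) (interchange a b (- c) (- d))

    ⟦reduce⟧≈ : ∀ a b → ⟦ reduce a b ⟧ ≈ ι a - ι b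
    ⟦reduce⟧≈ a       zero    = ⟦⟧≈ a 0
    ⟦reduce⟧≈ zero    (suc b) = refl
    ⟦reduce⟧≈ (suc a) (suc b) = begin
      ⟦ reduce a b ⟧              ≈⟨ ⟦reduce⟧≈ a b ⟩
      ι a - ι b                   ≈⟨ +-identityˡ _ ⟨
      0# + (ι a - ι b)            ≈⟨ +-congʳ (-‿inverseʳ 1#) ⟨
      (1# - 1#) + (ι a - ι b)     ≈⟨ medial _ _ _ _ ⟨
      ι (suc a) - ι (suc b)       ∎

    *-homo′ : ∀ a b c d → (a * c + b * d) - (a * d + b * c) ≈ (a - b) * (c - d)
    *-homo′ a b c d = begin
      (a * c + b * d) - (a * d + b * c)     ≈⟨ medial _ _ _ _ ⟩
      (a * c - a * d) + (b * d - b * c)     ≈⟨ +-cong (lemma a c d) (trans (sym (⁻¹-anti-homo‿- _ _)) (-‿cong (lemma b c d))) ⟩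
      a * (c - d) + - (b * (c - d))         ≈⟨ +-congˡ (-‿distribˡ-* b (c - d)) ⟩
      a * (c - d) + (- b) * (c - d)         ≈⟨ distribʳ (c - d) a (- b) ⟨
      (a - b) * (c - d)                     ∎
      where
      lemma : ∀ x y z → x * y - x * z ≈ x * (y - z)
      lemma x y z = trans (+-congˡ (-‿distribʳ-* x z)) (sym (distribˡ x y (- z)))

  differences⟶R : differences -Raw-AlmostCommutative⟶ fromCommutativeRing R
  differences⟶R = record
    { ⟦_⟧    = ⟦_⟧
    ; +-homo = λ (a , b) (c , d) → begin
        ⟦ reduce (a ℕ.+ c) (b ℕ.+ d) ⟧      ≈⟨ ⟦reduce⟧≈ (a ℕ.+ c) (b ℕ.+ d) ⟩
        ι (a ℕ.+ c) - ι (b ℕ.+ d)           ≈⟨ +-cong (×-homo-+ 1# a c) (-‿cong (×-homo-+ 1# b d)) ⟩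
        (ι a + ι c) - (ι b + ι d)           ≈⟨ medial (ι a) (ι c) (ι b) (ι d) ⟩
        (ι a - ι b) + (ι c - ι d)           ≈⟨ +-cong (⟦⟧≈ a b) (⟦⟧≈ c d) ⟨
        ⟦ a , b ⟧ + ⟦ c , d ⟧               ∎
    ; *-homo = λ (a , b) (c , d) → begin
        ⟦ reduce (a ℕ.* c ℕ.+ b ℕ.* d) (a ℕ.* d ℕ.+ b ℕ.* c) ⟧
          ≈⟨ ⟦reduce⟧≈ (a ℕ.* c ℕ.+ b ℕ.* d) (a ℕ.* d ℕ.+ b ℕ.* c) ⟩
        ι (a ℕ.* c ℕ.+ b ℕ.* d) - ι (a ℕ.* d ℕ.+ b ℕ.* c)
          ≈⟨ +-cong (trans (×-homo-+ 1# (a ℕ.* c) _) (+-cong (×1-homo-* a c) (×1-homo-* b d)))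
                    (-‿cong (trans (×-homo-+ 1# (a ℕ.* d) _) (+-cong (×1-homo-* a d) (×1-homo-* b c)))) ⟩
        (ι a * ι c + ι b * ι d) - (ι a * ι d + ι b * ι c)
          ≈⟨ *-homo′ (ι a) (ι b) (ι c) (ι d) ⟩
        (ι a - ι b) * (ι c - ι d)
          ≈⟨ *-cong (⟦⟧≈ a b) (⟦⟧≈ c d) ⟨
        ⟦ a , b ⟧ * ⟦ c , d ⟧ ∎
    ; -‿homo = λ (a , b) → begin
        ⟦ b , a ⟧                           ≈⟨ ⟦⟧≈ b a ⟩
        ι b - ι a                           ≈⟨ ⁻¹-anti-homo‿- (ι a) (ι b) ⟨
        - (ι a - ι b)                       ≈⟨ -‿cong (⟦⟧≈ a b) ⟨
        - ⟦ a , b ⟧                         ∎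
    ; 0-homo = -‿inverseʳ 0#
    ; 1-homo = refl
    }

  _≟ᶜ_ : (x y : ℕ × ℕ) → Maybe (⟦ x ⟧ ≈ ⟦ y ⟧)
  (a , b) ≟ᶜ (c , d) with a ℕ.+ d ℕ.≟ c ℕ.+ b
  ... | no  _     = nothing
  ... | yes a+d≡c+b = just (begin
    ⟦ a , b ⟧                     ≈⟨ ⟦⟧≈ a b ⟩
    ι a - ι b                     ≈⟨ +-identityʳ _ ⟨
    (ι a - ι b) + 0#              ≈⟨ +-congˡ (-‿inverseʳ (ι d)) ⟨
    (ι a - ι b) + (ι d - ι d)     ≈⟨ medial _ _ _ _ ⟨
    (ι a + ι d) - (ι b + ι d)     ≈⟨ +-cong eq (-‿cong (+-comm (ι b) (ι d))) ⟩
    (ι c + ι b) - (ι d + ι b)     ≈⟨ medial _ _ _ _ ⟩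
    (ι c - ι d) + (ι b - ι b)     ≈⟨ +-congˡ (-‿inverseʳ (ι b)) ⟩
    (ι c - ι d) + 0#              ≈⟨ +-identityʳ _ ⟩
    ι c - ι d                     ≈⟨ ⟦⟧≈ c d ⟨
    ⟦ c , d ⟧                     ∎)
    where
    eq : ι a + ι d ≈ ι c + ι b
    eq = trans (sym (×-homo-+ 1# a d)) (trans (reflexive (≡.cong ι a+d≡c+b)) (×-homo-+ 1# c b))

  open RingSolver differences (fromCommutativeRing R) differences⟶R _≟ᶜ_ public
    using (Polynomial; solve; _:=_; _:+_; _:*_; _:-_; :-_; con)

-- The ring of truncated power series

module SeriesProperties {c ℓ : Level} (R : CommutativeRing c ℓ) where
  open CommutativeRing R hiding (zero)
  open PowerSeries R
  open CommutativeSemigroupProperties +-commutativeSemigroup using (interchange)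
  open SetoidReasoning setoid

  infix 4 _≋_

  _≋_ : Series → Series → Set ℓ
  f ≋ g = ∀ n → f n ≈ g n

  -- Splitting off i = 0 leaves a convolution with the tail of `f`, so the laws of `⊗` follow by
  -- induction on the coefficient, without reindexing double sums.
  ⊗-suc : ∀ f g n → (f ⊗ g) (suc n) ≡ f 0 * g (suc n) + ((λ i → f (suc i)) ⊗ g) n
  ⊗-suc f g n = ≡.cong (λ xs → f 0 * g (suc n) + sumL xs)
    (≡.trans (map-applyUpTo suc (λ i → f i * g (suc n ℕ.∸ i)) (suc n))
             (≡.sym (map-applyUpTo (λ i → i) (λ i → f (suc i) * g (n ℕ.∸ i)) (suc n))))

  -- Coefficient `n` of a product sees only coefficients up to `n`; this makes equality up to order
  -- `N` a congruence for `⊗`.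
  ⊗-cong-upTo : ∀ n {f f′ g g′} → (∀ i → i ≤ n → f i ≈ f′ i) → (∀ i → i ≤ n → g i ≈ g′ i) →
                (f ⊗ g) n ≈ (f′ ⊗ g′) n
  ⊗-cong-upTo zero    f≈f′ g≈g′ = +-congʳ (*-cong (f≈f′ 0 z≤n) (g≈g′ 0 z≤n))
  ⊗-cong-upTo (suc n) {f} {f′} {g} {g′} f≈f′ g≈g′ = begin
    (f ⊗ g) (suc n)                                     ≡⟨ ⊗-suc f g n ⟩
    f 0 * g (suc n) + ((λ i → f (suc i)) ⊗ g) n         ≈⟨ +-cong (*-cong (f≈f′ 0 z≤n) (g≈g′ (suc n) ℕ.≤-refl))
                                                            (⊗-cong-upTo n (λ i i≤n → f≈f′ (suc i) (s≤s i≤n))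
                                                                           (λ i i≤n → g≈g′ i (ℕ.m≤n⇒m≤1+n i≤n))) ⟩
    f′ 0 * g′ (suc n) + ((λ i → f′ (suc i)) ⊗ g′) n     ≡⟨ ⊗-suc f′ g′ n ⟨
    (f′ ⊗ g′) (suc n)                                   ∎

  ⊗-cong : ∀ {f f′ g g′} → f ≋ f′ → g ≋ g′ → f ⊗ g ≋ f′ ⊗ g′
  ⊗-cong f≋f′ g≋g′ n = ⊗-cong-upTo n (λ i _ → f≋f′ i) (λ i _ → g≋g′ i)

  ⊗-sucʳ : ∀ f g n → (f ⊗ g) (suc n) ≈ (f ⊗ (λ i → g (suc i))) n + f (suc n) * g 0
  ⊗-sucʳ f g zero = begin
    f 0 * g 1 + (f 1 * g 0 + 0#)    ≈⟨ +-congˡ (+-identityʳ _) ⟩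
    f 0 * g 1 + f 1 * g 0           ≈⟨ +-congʳ (+-identityʳ _) ⟨
    f 0 * g 1 + 0# + f 1 * g 0      ∎
  ⊗-sucʳ f g (suc n) = begin
    (f ⊗ g) (2 ℕ.+ n)                                         ≡⟨ ⊗-suc f g (suc n) ⟩
    f 0 * g (2 ℕ.+ n) + (f′ ⊗ g) (suc n)                      ≈⟨ +-congˡ (⊗-sucʳ f′ g n) ⟩
    f 0 * g (2 ℕ.+ n) + ((f′ ⊗ g′) n + f (2 ℕ.+ n) * g 0)     ≈⟨ +-assoc _ _ _ ⟨
    f 0 * g (2 ℕ.+ n) + (f′ ⊗ g′) n + f (2 ℕ.+ n) * g 0       ≡⟨ ≡.cong (_+ f (2 ℕ.+ n) * g 0) (⊗-suc f g′ n) ⟨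
    (f ⊗ g′) (suc n) + f (2 ℕ.+ n) * g 0                      ∎
    where
    f′ g′ : Series
    f′ i = f (suc i)
    g′ i = g (suc i)

  ⊗-comm : ∀ f g → f ⊗ g ≋ g ⊗ f
  ⊗-comm f g zero    = +-congʳ (*-comm (f 0) (g 0))
  ⊗-comm f g (suc n) = begin
    (f ⊗ g) (suc n)                                   ≡⟨ ⊗-suc f g n ⟩
    f 0 * g (suc n) + ((λ i → f (suc i)) ⊗ g) n       ≈⟨ +-cong (*-comm _ _) (⊗-comm _ g n) ⟩
    g (suc n) * f 0 + (g ⊗ (λ i → f (suc i))) n       ≈⟨ +-comm _ _ ⟩
    (g ⊗ (λ i → f (suc i))) n + g (suc n) * f 0       ≈⟨ ⊗-sucʳ g f n ⟨
    (g ⊗ f) (suc n)                                   ∎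

  ⊗-distribʳ : ∀ h f g → (f ⊕ g) ⊗ h ≋ (f ⊗ h) ⊕ (g ⊗ h)
  ⊗-distribʳ h f g zero = begin
    (f 0 + g 0) * h 0 + 0#                        ≈⟨ +-cong (distribʳ _ _ _) (sym (+-identityʳ 0#)) ⟩
    f 0 * h 0 + g 0 * h 0 + (0# + 0#)             ≈⟨ interchange _ _ _ _ ⟩
    f 0 * h 0 + 0# + (g 0 * h 0 + 0#)             ∎
  ⊗-distribʳ h f g (suc n) = begin
    ((f ⊕ g) ⊗ h) (suc n)                                             ≡⟨ ⊗-suc (f ⊕ g) h n ⟩
    (f 0 + g 0) * h (suc n) + ((f′ ⊕ g′) ⊗ h) n                       ≈⟨ +-cong (distribʳ _ _ _) (⊗-distribʳ h f′ g′ n) ⟩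
    (f 0 * h (suc n) + g 0 * h (suc n)) + ((f′ ⊗ h) n + (g′ ⊗ h) n)   ≈⟨ interchange _ _ _ _ ⟩
    (f 0 * h (suc n) + (f′ ⊗ h) n) + (g 0 * h (suc n) + (g′ ⊗ h) n)   ≡⟨ ≡.cong₂ _+_ (⊗-suc f h n) (⊗-suc g h n) ⟨
    ((f ⊗ h) ⊕ (g ⊗ h)) (suc n)                                       ∎
    where
    f′ g′ : Series
    f′ i = f (suc i)
    g′ i = g (suc i)

  ·-⊗ : ∀ a f g → (a · f) ⊗ g ≋ a · (f ⊗ g)
  ·-⊗ a f g zero = begin
    a * f 0 * g 0 + 0#        ≈⟨ +-cong (*-assoc _ _ _) (sym (zeroʳ a)) ⟩
    a * (f 0 * g 0) + a * 0#  ≈⟨ distribˡ _ _ _ ⟨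
    a * (f 0 * g 0 + 0#)      ∎
  ·-⊗ a f g (suc n) = begin
    ((a · f) ⊗ g) (suc n)                                           ≡⟨ ⊗-suc (a · f) g n ⟩
    a * f 0 * g (suc n) + ((a · (λ i → f (suc i))) ⊗ g) n           ≈⟨ +-cong (*-assoc _ _ _) (·-⊗ a _ g n) ⟩
    a * (f 0 * g (suc n)) + a * ((λ i → f (suc i)) ⊗ g) n           ≈⟨ distribˡ _ _ _ ⟨
    a * (f 0 * g (suc n) + ((λ i → f (suc i)) ⊗ g) n)               ≡⟨ ≡.cong (a *_) (⊗-suc f g n) ⟨
    a * (f ⊗ g) (suc n)                                             ∎

  ⊗-assoc : ∀ f g h → (f ⊗ g) ⊗ h ≋ f ⊗ (g ⊗ h)
  ⊗-assoc f g h zero = +-congʳ (begin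
    (f 0 * g 0 + 0#) * h 0    ≈⟨ *-congʳ (+-identityʳ _) ⟩
    f 0 * g 0 * h 0           ≈⟨ *-assoc _ _ _ ⟩
    f 0 * (g 0 * h 0)         ≈⟨ *-congˡ (+-identityʳ _) ⟨
    f 0 * (g 0 * h 0 + 0#)    ∎)
  ⊗-assoc f g h (suc n) = begin
    ((f ⊗ g) ⊗ h) (suc n)
      ≡⟨ ⊗-suc (f ⊗ g) h n ⟩
    (f ⊗ g) 0 * h (suc n) + ((λ i → (f ⊗ g) (suc i)) ⊗ h) n
      -- The tail of `f ⊗ g` is `(f 0 · g′) ⊕ (f′ ⊗ g)`, to which distributivity and induction
      -- apply.
      ≈⟨ +-cong (trans (*-congʳ (+-identityʳ _)) (*-assoc _ _ _))
                (⊗-cong {g = h} (λ i → reflexive (⊗-suc f g i)) (λ _ → refl) n) ⟩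
    f 0 * (g 0 * h (suc n)) + (((f 0 · g′) ⊕ (f′ ⊗ g)) ⊗ h) n
      ≈⟨ +-congˡ (trans (⊗-distribʳ h _ _ n) (+-cong (·-⊗ (f 0) g′ h n) (⊗-assoc f′ g h n))) ⟩
    f 0 * (g 0 * h (suc n)) + (f 0 * (g′ ⊗ h) n + (f′ ⊗ (g ⊗ h)) n)
      ≈⟨ +-assoc _ _ _ ⟨
    f 0 * (g 0 * h (suc n)) + f 0 * (g′ ⊗ h) n + (f′ ⊗ (g ⊗ h)) n
      ≈⟨ +-congʳ (distribˡ _ _ _) ⟨
    f 0 * (g 0 * h (suc n) + (g′ ⊗ h) n) + (f′ ⊗ (g ⊗ h)) n
      ≡⟨ ≡.cong (λ x → f 0 * x + (f′ ⊗ (g ⊗ h)) n) (⊗-suc g h n) ⟨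
    f 0 * (g ⊗ h) (suc n) + (f′ ⊗ (g ⊗ h)) n
      ≡⟨ ⊗-suc f (g ⊗ h) n ⟨
    (f ⊗ (g ⊗ h)) (suc n) ∎
    where
    f′ g′ : Series
    f′ i = f (suc i)
    g′ i = g (suc i)

  zero-⊗ : ∀ g → (λ _ → 0#) ⊗ g ≋ (λ _ → 0#)
  zero-⊗ g zero    = trans (+-identityʳ _) (zeroˡ _)
  zero-⊗ g (suc n) = begin
    ((λ _ → 0#) ⊗ g) (suc n)                  ≡⟨ ⊗-suc (λ _ → 0#) g n ⟩
    0# * g (suc n) + ((λ _ → 0#) ⊗ g) n       ≈⟨ +-cong (zeroˡ _) (zero-⊗ g n) ⟩
    0# + 0#                                   ≈⟨ +-identityʳ 0# ⟩
    0#                                        ∎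

  κ-⊗ : ∀ a g → κ a ⊗ g ≋ a · g
  κ-⊗ a g zero    = +-identityʳ _
  κ-⊗ a g (suc n) = begin
    (κ a ⊗ g) (suc n)                         ≡⟨ ⊗-suc (κ a) g n ⟩
    a * g (suc n) + ((λ _ → 0#) ⊗ g) n        ≈⟨ +-congˡ (zero-⊗ g n) ⟩
    a * g (suc n) + 0#                        ≈⟨ +-identityʳ _ ⟩
    a * g (suc n)                             ∎

  ⊗-identityˡ : ∀ g → κ 1# ⊗ g ≋ g
  ⊗-identityˡ g n = trans (κ-⊗ 1# g n) (*-identityˡ (g n))

  X·-⊗ : ∀ f g → X· f ⊗ g ≋ X· (f ⊗ g)
  X·-⊗ f g zero    = trans (+-identityʳ _) (zeroˡ _)
  X·-⊗ f g (suc n) = begin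
    (X· f ⊗ g) (suc n)              ≡⟨ ⊗-suc (X· f) g n ⟩
    0# * g (suc n) + (f ⊗ g) n      ≈⟨ +-congʳ (zeroˡ _) ⟩
    0# + (f ⊗ g) n                  ≈⟨ +-identityˡ _ ⟩
    (f ⊗ g) n                       ∎

  X·-cong : ∀ {f g} → f ≋ g → X· f ≋ X· g
  X·-cong f≋g zero    = refl
  X·-cong f≋g (suc n) = f≋g n

  𝕏 : Series
  𝕏 = X· (κ 1#)

  X·≋𝕏⊗ : ∀ g → X· g ≋ 𝕏 ⊗ g
  X·≋𝕏⊗ g n = sym (trans (X·-⊗ (κ 1#) g n) (X·-cong (⊗-identityˡ g) n))

  -- R[x] / (x^(N+1)): equality only compares the coefficients up to N.
  truncated : ℕ → CommutativeRing c ℓ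
  truncated N = record
    { Carrier = Series
    ; _≈_     = λ f g → ∀ n → n ≤ N → f n ≈ g n
    ; _+_     = _⊕_
    ; _*_     = _⊗_
    ; -_      = ⊖_
    ; 0#      = λ _ → 0#
    ; 1#      = κ 1#
    ; isCommutativeRing = record
      { isRing = record
        { +-isAbelianGroup = record
          { isGroup = record
            { isMonoid = record
              { isSemigroup = record
                { isMagma = record
                  { isEquivalence = record
                    { refl  = λ _ _ → refl
                    ; sym   = λ f≈g n n≤N → sym (f≈g n n≤N)
                    ; trans = λ f≈g g≈h n n≤N → trans (f≈g n n≤N) (g≈h n n≤N)
                    }
                  ; ∙-cong = λ f≈f′ g≈g′ n n≤N → +-cong (f≈f′ n n≤N) (g≈g′ n n≤N)
                  }
                ; assoc = λ f g h n _ → +-assoc (f n) (g n) (h n)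
                }
              ; identity = (λ f n _ → +-identityˡ (f n)) , (λ f n _ → +-identityʳ (f n))
              }
            ; inverse = (λ f n _ → -‿inverseˡ (f n)) , (λ f n _ → -‿inverseʳ (f n))
            ; ⁻¹-cong = λ f≈g n n≤N → -‿cong (f≈g n n≤N)
            }
          ; comm = λ f g n _ → +-comm (f n) (g n)
          }
        ; *-cong = λ f≈f′ g≈g′ n n≤N →
            ⊗-cong-upTo n (λ i i≤n → f≈f′ i (ℕ.≤-trans i≤n n≤N)) (λ i i≤n → g≈g′ i (ℕ.≤-trans i≤n n≤N))
        ; *-assoc = λ f g h n _ → ⊗-assoc f g h n
        ; *-identity = (λ f n _ → ⊗-identityˡ f n) ,
                       (λ f n _ → trans (⊗-comm f (κ 1#) n) (⊗-identityˡ f n))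
        ; distrib = (λ f g h n _ → trans (⊗-comm f (g ⊕ h) n)
                       (trans (⊗-distribʳ f g h n) (+-cong (⊗-comm g f n) (⊗-comm h f n)))) ,
                    (λ f g h n _ → ⊗-distribʳ f g h n)
        }
      ; *-comm = λ f g n _ → ⊗-comm f g n
      }
    }

-- The recursion over levels and its product law

module LevelRecursion {c ℓ : Level} (R : CommutativeRing c ℓ)
                      (p q r : CommutativeRing.Carrier R) (N : ℕ) where
  open CommutativeRing R hiding (zero)
  open PowerSeries R
  open SeriesProperties R
  open CommutativeSemigroupProperties *-commutativeSemigroup using (x∙yz≈y∙xz)
  open SetoidReasoning setoid

  Σ< : ℕ → (ℕ → Carrier) → Carrier
  Σ< k g = sumL (applyUpTo g k)

  Σ<-cong : ∀ k {g h} → (∀ t → g t ≈ h t) → Σ< k g ≈ Σ< k h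
  Σ<-cong zero    g≈h = refl
  Σ<-cong (suc k) g≈h = +-cong (g≈h 0) (Σ<-cong k (λ t → g≈h (suc t)))

  Σ<-zero : ∀ k → Σ< k (λ _ → 0#) ≈ 0#
  Σ<-zero zero    = refl
  Σ<-zero (suc k) = trans (+-identityˡ _) (Σ<-zero k)

  Σ<-distribˡ : ∀ k x g → x * Σ< k g ≈ Σ< k (λ t → x * g t)
  Σ<-distribˡ zero    x g = zeroʳ x
  Σ<-distribˡ (suc k) x g = trans (distribˡ x _ _) (+-congˡ (Σ<-distribˡ k x (λ t → g (suc t))))

  Σ<-shift : ∀ k g → g 0 + Σ< k (λ t → g (suc t)) ≈ Σ< k g + g k
  Σ<-shift zero    g = trans (+-identityʳ _) (sym (+-identityˡ _))
  Σ<-shift (suc k) g = trans (+-congˡ (Σ<-shift k (λ t → g (suc t)))) (sym (+-assoc _ _ _))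

  Σ<-⊗ : ∀ k (F : ℕ → Series) g n → ((λ i → Σ< k (λ t → F t i)) ⊗ g) n ≈ Σ< k (λ t → (F t ⊗ g) n)
  Σ<-⊗ zero    F g n = zero-⊗ g n
  Σ<-⊗ (suc k) F g n = trans (⊗-distribʳ g (F 0) _ n) (+-congˡ (Σ<-⊗ k (λ t → F (suc t)) g n))

  T : Carrier → (ℕ → Carrier) → ℕ → Carrier
  T x a m = x * a m + r * Σ< N (λ t → a (suc t ℕ.+ m))

  T-cong : ∀ x {a b} → (∀ m → a m ≈ b m) → ∀ m → T x a m ≈ T x b m
  T-cong x a≈b m = +-cong (*-congˡ (a≈b m)) (*-congˡ (Σ<-cong N (λ t → a≈b (suc t ℕ.+ m))))

  T-vanish : ∀ x {a m} → (∀ k → m ≤ k → a k ≈ 0#) → ∀ k → m ≤ k → T x a k ≈ 0#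
  T-vanish x {a} {m} a≈0 k m≤k = begin
    x * a k + r * Σ< N (λ t → a (suc t ℕ.+ k))   ≈⟨ +-cong (*-congˡ (a≈0 k m≤k)) (*-congˡ (trans
                                                     (Σ<-cong N (λ t → a≈0 _ (ℕ.≤-trans m≤k (ℕ.m≤n+m k (suc t)))))
                                                     (Σ<-zero N))) ⟩
    x * 0# + r * 0#                              ≈⟨ +-cong (zeroʳ x) (zeroʳ r) ⟩
    0# + 0#                                      ≈⟨ +-identityʳ 0# ⟩
    0#                                           ∎

  T-scale : ∀ x y a m → T x (λ k → y * a k) m ≈ y * T x a m
  T-scale x y a m = begin
    x * (y * a m) + r * Σ< N (λ t → y * a (suc t ℕ.+ m))  ≈⟨ +-cong (x∙yz≈y∙xz x y _)
                                                               (trans (*-congˡ (sym (Σ<-distribˡ N y _))) (x∙yz≈y∙xz r y _)) ⟩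
    y * (x * a m) + y * (r * Σ< N (λ t → a (suc t ℕ.+ m))) ≈⟨ distribˡ y _ _ ⟨
    y * T x a m                                           ∎

  -- `T` refers to levels only relative to its argument, so it commutes with raising the level
  -- index.
  T-shift : ∀ x a k m → T x a (suc (k ℕ.+ m)) ≈ T x (λ s → a (suc (s ℕ.+ m))) k
  T-shift x a k m = +-congˡ (*-congˡ (Σ<-cong N (λ t → reflexive (≡.cong a
    (≡.trans (ℕ.+-suc (suc t) (k ℕ.+ m)) (≡.cong suc (≡.sym (ℕ.+-assoc (suc t) k m))))))))

  T-⊗ : ∀ x (F : ℕ → Series) g m n →
        ((λ i → T x (λ k → F k i) m) ⊗ g) n ≈ T x (λ k → (F k ⊗ g) n) m
  T-⊗ x F g m n = trans (⊗-distribʳ g _ _ n) (+-cong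
    (·-⊗ x (F m) g n)
    (trans (·-⊗ r _ g n) (*-congˡ (Σ<-⊗ N (λ t → F (suc t ℕ.+ m)) g n))))

  -- The cutoff is part of the recursion itself, so the product law and the equation for `A 0` hold
  -- for all coefficients; within this recursion, only `z-equation` is restricted to order `N`.
  a : ℕ → ℕ → Carrier
  a zero    zero    = 1#
  a zero    (suc m) = 0#
  a (suc n) zero    = T q (T p (a n)) zero
  a (suc n) (suc m) = p * q * a n m + T q (T p (a n)) (suc m)

  A : ℕ → Series
  A m n = a n m

  a-vanish : ∀ n m → n < m → a n m ≈ 0#
  a-vanish zero    (suc m) _         = refl
  a-vanish (suc n) (suc m) (s≤s n<m) = begin
    p * q * a n m + T q (T p (a n)) (suc m)   ≈⟨ +-cong (*-congˡ (a-vanish n m n<m))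
                                                   (T-vanish q (T-vanish p (λ k → a-vanish n k)) (suc m) (ℕ.m≤n⇒m≤1+n n<m)) ⟩
    p * q * 0# + 0#                           ≈⟨ +-identityʳ _ ⟩
    p * q * 0#                                ≈⟨ zeroʳ _ ⟩
    0#                                        ∎

  Y : Series → Series
  Y f = (p * q) · X· f

  -- By induction on the order, A_{s+m+1} = y A_s A_m for all s turns x T_q T_p A at level k + m + 1
  -- into y A_m times x T_q T_p A at level k, since T is linear and commutes with level shifts. The
  -- other term y A_{k+m} is y A_m times y A_{k-1}, or times 1 if k = 0. Together they are y A_m
  -- times the recursion for A_k.
  A-product : ∀ n k m → a n (suc (k ℕ.+ m)) ≈ Y (A k ⊗ A m) n

  TT-product : ∀ n k m →
    T q (T p (a n)) (suc (k ℕ.+ m)) ≈ T q (T p (λ s → Y (A s ⊗ A m) n)) k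
  TT-product n k m = begin
    T q (T p (a n)) (suc (k ℕ.+ m))                   ≈⟨ T-shift q (T p (a n)) k m ⟩
    T q (λ s → T p (a n) (suc (s ℕ.+ m))) k           ≈⟨ T-cong q (λ s → T-shift p (a n) s m) k ⟩
    T q (T p (λ s → a n (suc (s ℕ.+ m)))) k           ≈⟨ T-cong q (T-cong p (λ s → A-product n s m)) k ⟩
    T q (T p (λ s → Y (A s ⊗ A m) n)) k               ∎

  TT-⊗ : ∀ n k m → T q (T p (λ s → Y (A s ⊗ A m) (suc n))) k ≈
                   p * q * ((λ i → T q (T p (a i)) k) ⊗ A m) n
  TT-⊗ n k m = begin
    T q (T p (λ s → p * q * (A s ⊗ A m) n)) k       ≈⟨ T-cong q (T-scale p (p * q) (λ s → (A s ⊗ A m) n)) k ⟩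
    T q (λ s → p * q * T p (λ s → (A s ⊗ A m) n) s) k  ≈⟨ T-scale q (p * q) (T p (λ s → (A s ⊗ A m) n)) k ⟩
    p * q * T q (T p (λ s → (A s ⊗ A m) n)) k       ≈⟨ *-congˡ (T-cong q (λ s → T-⊗ p A (A m) s n) k) ⟨
    p * q * T q (λ s → ((λ i → T p (a i) s) ⊗ A m) n) k ≈⟨ *-congˡ (T-⊗ q (λ s i → T p (a i) s) (A m) k n) ⟨
    p * q * ((λ i → T q (T p (a i)) k) ⊗ A m) n     ∎

  A-product zero          k       m = sym (zeroʳ _)
  -- Order 1 is separate because `Y` delays by one power of x: `TT-⊗` needs a positive order, while
  -- at order 0 all positive levels vanish.
  A-product (suc zero)    k       m = begin
    p * q * a 0 (k ℕ.+ m) + T q (T p (a 0)) (suc (k ℕ.+ m))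
      ≈⟨ +-cong (*-congˡ (initial k)) (T-vanish q (T-vanish p (a-vanish 0)) (suc (k ℕ.+ m)) (s≤s z≤n)) ⟩
    p * q * (A k ⊗ A m) 0 + 0#
      ≈⟨ +-identityʳ _ ⟩
    p * q * (A k ⊗ A m) 0 ∎
    where
    initial : ∀ k → a 0 (k ℕ.+ m) ≈ (A k ⊗ A m) 0
    initial zero    = sym (trans (+-identityʳ _) (*-identityˡ _))
    initial (suc k) = sym (trans (+-identityʳ _) (zeroˡ _))
  A-product (suc (suc n)) zero    m = begin
    p * q * a (suc n) m + T q (T p (a (suc n))) (suc m)
      ≈⟨ +-cong (*-congˡ (sym (*-identityˡ _))) (trans (TT-product (suc n) 0 m) (TT-⊗ n 0 m)) ⟩
    p * q * (1# * a (suc n) m) + p * q * ((λ i → T q (T p (a i)) 0) ⊗ A m) n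
      ≈⟨ distribˡ _ _ _ ⟨
    p * q * (1# * a (suc n) m + ((λ i → T q (T p (a i)) 0) ⊗ A m) n)
      ≡⟨ ≡.cong (p * q *_) (⊗-suc (A 0) (A m) n) ⟨
    p * q * (A 0 ⊗ A m) (suc n) ∎
  A-product (suc (suc n)) (suc k) m = begin
    p * q * a (suc n) (suc (k ℕ.+ m)) + T q (T p (a (suc n))) (suc (suc k ℕ.+ m))
      ≈⟨ +-cong (*-congˡ (A-product (suc n) k m)) (trans (TT-product (suc n) (suc k) m) (TT-⊗ n (suc k) m)) ⟩
    p * q * (p * q * (A k ⊗ A m) n) + p * q * ((λ i → T q (T p (a i)) (suc k)) ⊗ A m) n
      ≈⟨ distribˡ _ _ _ ⟨
    p * q * (p * q * (A k ⊗ A m) n + ((λ i → T q (T p (a i)) (suc k)) ⊗ A m) n)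
      ≈⟨ *-congˡ (+-congʳ (·-⊗ (p * q) (A k) (A m) n)) ⟨
    p * q * (((p * q · A k) ⊗ A m) n + ((λ i → T q (T p (a i)) (suc k)) ⊗ A m) n)
      -- The two left factors add up to the defining recursion of `a (suc i) (suc k)`.
      ≈⟨ *-congˡ (⊗-distribʳ (A m) _ _ n) ⟨
    p * q * ((λ i → a (suc i) (suc k)) ⊗ A m) n
      ≈⟨ *-congˡ (trans (+-congʳ (zeroˡ _)) (+-identityˡ _)) ⟨
    p * q * (0# * a (suc n) m + ((λ i → a (suc i) (suc k)) ⊗ A m) n)
      ≡⟨ ≡.cong (p * q *_) (⊗-suc (A (suc k)) (A m) n) ⟨
    p * q * (A (suc k) ⊗ A m) (suc n) ∎

  ΣA z : Series
  ΣA i = Σ< N (a i)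
  z    = Y ΣA

  Y-⊗ : ∀ f g → Y f ⊗ g ≋ Y (f ⊗ g)
  Y-⊗ f g n = trans (·-⊗ (p * q) (X· f) g n) (*-congˡ (X·-⊗ f g n))

  Y-cong : ∀ {f g} → f ≋ g → Y f ≋ Y g
  Y-cong f≋g n = *-congˡ (X·-cong f≋g n)

  Σ<-Y : ∀ k (F : ℕ → Series) n → Σ< k (λ t → Y (F t) n) ≈ Y (λ i → Σ< k (λ t → F t i)) n
  Σ<-Y k F zero    = trans (sym (Σ<-distribˡ k (p * q) (λ _ → 0#))) (*-congˡ (Σ<-zero k))
  Σ<-Y k F (suc n) = sym (Σ<-distribˡ k (p * q) (λ t → F t n))

  -- The product law summed over k: passing from level m to the levels above it is multiplication by
  -- z.
  ΣA-⊗ : ∀ m n → Σ< N (λ t → a n (suc t ℕ.+ m)) ≈ (z ⊗ A m) n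
  ΣA-⊗ m n = begin
    Σ< N (λ t → a n (suc t ℕ.+ m))          ≈⟨ Σ<-cong N (λ t → A-product n t m) ⟩
    Σ< N (λ t → Y (A t ⊗ A m) n)            ≈⟨ Σ<-Y N (λ t → A t ⊗ A m) n ⟩
    Y (λ i → Σ< N (λ t → (A t ⊗ A m) i)) n  ≈⟨ Y-cong (Σ<-⊗ N A (A m)) n ⟨
    Y (ΣA ⊗ A m) n                          ≈⟨ Y-⊗ ΣA (A m) n ⟨
    (z ⊗ A m) n                             ∎

  factor : Carrier → Series
  factor x = κ x ⊕ (r · z)

  T-A : ∀ x m n → T x (a n) m ≈ (factor x ⊗ A m) n
  T-A x m n = sym (begin
    (factor x ⊗ A m) n                       ≈⟨ ⊗-distribʳ (A m) (κ x) (r · z) n ⟩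
    (κ x ⊗ A m) n + ((r · z) ⊗ A m) n        ≈⟨ +-cong (κ-⊗ x (A m) n)
                                                  (trans (·-⊗ r z (A m) n) (*-congˡ (sym (ΣA-⊗ m n)))) ⟩
    T x (a n) m                              ∎)

  A₀-equation : A 0 ≋ κ 1# ⊕ X· (factor q ⊗ A 0 ⊗ factor p)
  A₀-equation zero    = sym (+-identityʳ 1#)
  A₀-equation (suc n) = begin
    -- With the factor for `p` written on the right, `T-⊗` can pull it out of the operator for `q`.
    T q (T p (a n)) 0                                 ≈⟨ T-cong q (λ m → trans (T-A p m n) (⊗-comm (factor p) (A m) n)) 0 ⟩
    T q (λ m → (A m ⊗ factor p) n) 0                  ≈⟨ T-⊗ q A (factor p) 0 n ⟨
    ((λ i → T q (a i) 0) ⊗ factor p) n                ≈⟨ ⊗-cong {g = factor p} (T-A q 0) (λ _ → refl) n ⟩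
    (factor q ⊗ A 0 ⊗ factor p) n                     ≈⟨ +-identityˡ _ ⟨
    0# + (factor q ⊗ A 0 ⊗ factor p) n                ∎

  -- By `ΣA-⊗` at level 0, A₀ z is the sum of the levels 1 to N. Adding A₀ exceeds the sum defining
  -- z by A_N, whose coefficients vanish below order N; the factor x in y extends this to order N.
  z-equation : ∀ n → n ≤ N → (Y (A 0) ⊕ (Y (A 0) ⊗ z)) n ≈ z n
  z-equation n n≤N = begin
    Y (A 0) n + (Y (A 0) ⊗ z) n         ≈⟨ +-congˡ (Y-⊗ (A 0) z n) ⟩
    Y (A 0) n + Y (A 0 ⊗ z) n           ≈⟨ +-congˡ (Y-cong A₀⊗z n) ⟩
    Y (A 0) n + Y ΣA⁺ n                 ≈⟨ telescope n n≤N ⟩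
    z n                                 ∎
    where
    ΣA⁺ : Series
    ΣA⁺ i = Σ< N (λ t → a i (suc t))
    A₀⊗z : A 0 ⊗ z ≋ ΣA⁺
    A₀⊗z i = begin
      (A 0 ⊗ z) i                       ≈⟨ ⊗-comm (A 0) z i ⟩
      (z ⊗ A 0) i                       ≈⟨ ΣA-⊗ 0 i ⟨
      Σ< N (λ t → a i (suc t ℕ.+ 0))    ≈⟨ Σ<-cong N (λ t → reflexive (≡.cong (a i) (ℕ.+-identityʳ (suc t)))) ⟩
      ΣA⁺ i                             ∎
    telescope : ∀ n → n ≤ N → Y (A 0) n + Y ΣA⁺ n ≈ Y ΣA n
    telescope zero    _   = trans (+-cong (zeroʳ _) (zeroʳ _)) (trans (+-identityʳ 0#) (sym (zeroʳ _)))
    telescope (suc n) n<N = begin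
      p * q * a n 0 + p * q * ΣA⁺ n     ≈⟨ distribˡ _ _ _ ⟨
      p * q * (a n 0 + ΣA⁺ n)           ≈⟨ *-congˡ (Σ<-shift N (a n)) ⟩
      p * q * (ΣA n + a n N)            ≈⟨ *-congˡ (+-congˡ (a-vanish n N n<N)) ⟩
      p * q * (ΣA n + 0#)               ≈⟨ *-congˡ (+-identityʳ _) ⟩
      p * q * ΣA n                      ∎

-- Elimination of z

module _ {c ℓ : Level} (R : CommutativeRing c ℓ) where
  open CommutativeRing R hiding (zero)
  open DifferenceSolver R
  open SetoidReasoning setoid

  -- With u = 1 - y f and y = p q x, the second hypothesis reads u z = y f, and the cubic is
  -- u² times the first hypothesis.
  eliminate : ∀ x p q r f z →
    f ≈ 1# + x * ((q + r * z) * f * (p + r * z)) →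
    (p * q) * (x * f) + (p * q) * (x * f) * z ≈ z →
    f ≈ 1# + (p * q) * (x * ((- 1# + ((1# + 1#) + x * (p * r + q * r - p * q)) * f)
              - (p * q) * (x * (1# - x * ((p - r) * (q - r)))) * (f * f))) * f
  eliminate x p q r f z f-eq z-eq = sym (begin
    1# + (p * q) * (x * ((- 1# + ((1# + 1#) + x * (p * r + q * r - p * q)) * f)
              - (p * q) * (x * (1# - x * ((p - r) * (q - r)))) * (f * f))) * f
      -- Since q u + r w = q - (q - r) w, and likewise for p, the w² term of the product carries the
      -- coefficient (p - r)(q - r) of the cubic.
      ≈⟨ solve 5 (λ x p q r f → let one = con (1 , 0); w = p :* q :* (x :* f); u = one :- w in
           one :+ (p :* q) :* (x :* ((:- one :+ ((one :+ one) :+ x :* (p :* r :+ q :* r :- p :* q)) :* f)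
             :- (p :* q) :* (x :* (one :- x :* ((p :- r) :* (q :- r)))) :* (f :* f))) :* f
           := f :- (u :* u :* f :- (u :* u :+ x :* ((q :* u :+ r :* w) :* f :* (p :* u :+ r :* w)))))
           refl x p q r f ⟩
    f - (u * u * f - (u * u + x * ((q * u + r * w) * f * (p * u + r * w))))
      -- With w = u z both factors become divisible by u, so u² can be taken out of the whole
      -- difference.
      ≈⟨ +-congˡ (-‿cong (+-congˡ (-‿cong (+-congˡ (*-congˡ (*-cong (*-congʳ (+-congˡ (*-congˡ w≈uz))) (+-congˡ (*-congˡ w≈uz)))))))) ⟩
    f - (u * u * f - (u * u + x * ((q * u + r * (u * z)) * f * (p * u + r * (u * z)))))
      ≈⟨ solve 7 (λ x p q r f z u → 
           f :- (u :* u :* f :- (u :* u :+ x :* ((q :* u :+ r :* (u :* z)) :* f :* (p :* u :+ r :* (u :* z)))))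
           := f :- u :* u :* (f :- (con (1 , 0) :+ x :* ((q :+ r :* z) :* f :* (p :+ r :* z)))))
           refl x p q r f z u ⟩
    f - u * u * (f - (1# + x * ((q + r * z) * f * (p + r * z))))
      ≈⟨ +-congˡ (-‿cong (*-congˡ (+-congˡ (-‿cong f-eq)))) ⟨
    f - u * u * (f - f)
      ≈⟨ solve 2 (λ f u → f :- u :* u :* (f :- f) := f) refl f u ⟩
    f ∎)
    where
    w u : Carrier
    w = p * q * (x * f)
    u = 1# - w
    w≈uz : w ≈ u * z
    w≈uz = begin
      w                     ≈⟨ solve 2 (λ w z → w := (w :+ w :* z) :- w :* z) refl w z ⟩
      (w + w * z) - w * z   ≈⟨ +-congʳ z-eq ⟩
      z - w * z             ≈⟨ solve 2 (λ w z → z :- w :* z := (con (1 , 0) :- w) :* z) refl w z ⟩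
      u * z                 ∎

-- The cubic equation for truncated series

module _ {c ℓ : Level} (R : CommutativeRing c ℓ)
         (p q r : CommutativeRing.Carrier R) (N : ℕ) where
  open CommutativeRing R hiding (zero)
  open PowerSeries R
  open SeriesProperties R
  open LevelRecursion R p q r N
  private module S = CommutativeRing (truncated N)

  private
    exact : ∀ {f g} → f ≋ g → f S.≈ g
    exact f≋g n _ = f≋g n

    κ-homo-+ : ∀ a b → κ (a + b) S.≈ κ a ⊕ κ b
    κ-homo-+ a b zero    _ = refl
    κ-homo-+ a b (suc n) _ = sym (+-identityʳ 0#)

    κ-homo-minus : ∀ a b → κ (a - b) S.≈ κ a ⊝ κ b
    κ-homo-minus a b zero    _ = refl
    κ-homo-minus a b (suc n) _ = sym (-‿inverseʳ 0#)

    κ-homo-* : ∀ a b → κ (a * b) S.≈ κ a ⊗ κ b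
    κ-homo-* a b zero    _ = sym (κ-⊗ a (κ b) 0)
    κ-homo-* a b (suc n) _ = sym (trans (κ-⊗ a (κ b) (suc n)) (zeroʳ a))

    ·≈ : ∀ {f g} → f S.≈ g → (p * q) · f S.≈ κ p ⊗ κ q ⊗ g
    ·≈ {f} {g} f≈g = S.trans (exact (λ n → sym (κ-⊗ (p * q) f n))) (S.*-cong (κ-homo-* p q) f≈g)

    X·≈ : ∀ {f g} → f S.≈ g → X· f S.≈ 𝕏 ⊗ g
    X·≈ {f} f≈g = S.trans (exact (X·≋𝕏⊗ f)) (S.*-congˡ f≈g)

  -- This is `eliminate` in the truncated ring, with scalars and `X·` rewritten as multiplication by
  -- the series `κ` and `𝕏`.
  cubic : ∀ f → (∀ n → n ≤ N → f n ≈ a n 0) → ∀ n → n ≤ N →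
    f n ≈ (κ 1# ⊕ (((p * q) · X· (((⊖ (κ 1#))
            ⊕ ((κ (1# + 1#) ⊕ X· (κ (p * r + q * r - p * q))) ⊗ f))
            ⊝ (((p * q) · X· (κ 1# ⊝ X· (κ ((p - r) * (q - r))))) ⊗ (f ⊗ f)))) ⊗ f)) n
  cubic f f≈A₀ = S.trans
    (eliminate (truncated N) 𝕏 (κ p) (κ q) (κ r) f z
      (S.trans f≈A₀ (S.trans (exact A₀-equation)
        (S.+-congˡ (X·≈ (S.*-cong (S.*-cong factor≈ (S.sym f≈A₀)) factor≈)))))
      (S.trans (S.+-cong Yf≈ (S.*-congʳ Yf≈)) z-equation))
    (S.sym (S.+-congˡ (S.*-congʳ (·≈ (X·≈ (S.+-cong
      (S.+-congˡ (S.*-congʳ (S.+-cong (κ-homo-+ 1# 1#) (X·≈ κ₁≈))))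
      (S.-‿cong (S.*-congʳ (·≈ (X·≈ (S.+-congˡ (S.-‿cong (X·≈ κ₂≈)))))))))))))
    where
    factor≈ : ∀ {x} → factor x S.≈ κ x ⊕ (κ r ⊗ z)
    factor≈ = S.+-congˡ (exact (λ n → sym (κ-⊗ r z n)))
    Yf≈ : κ p ⊗ κ q ⊗ (𝕏 ⊗ f) S.≈ Y (A 0)
    Yf≈ = S.sym (·≈ (X·≈ (S.sym f≈A₀)))
    κ₁≈ : κ (p * r + q * r - p * q) S.≈ κ p ⊗ κ r ⊕ κ q ⊗ κ r ⊝ κ p ⊗ κ q
    κ₁≈ = S.trans (κ-homo-minus _ _) (S.+-cong
      (S.trans (κ-homo-+ _ _) (S.+-cong (κ-homo-* p r) (κ-homo-* q r))) (S.-‿cong (κ-homo-* p q)))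
    κ₂≈ : κ ((p - r) * (q - r)) S.≈ (κ p ⊝ κ r) ⊗ (κ q ⊝ κ r)
    κ₂≈ = S.trans (κ-homo-* _ _) (S.*-cong (κ-homo-minus p r) (κ-homo-minus q r))

-- Weights of marked words

module Weights {c ℓ : Level} (R : CommutativeRing c ℓ)
               (p q r : CommutativeRing.Carrier R) (N : ℕ) where
  open CommutativeRing R hiding (zero)
  open PowerSeries R
  open LevelRecursion R p q r N using (Σ<; Σ<-cong; Σ<-distribˡ; T; T-cong; a)
  open Words
  open Enumeration N
  open CommutativeSemigroupProperties *-commutativeSemigroup using (x∙yz≈y∙xz)
  open SetoidReasoning setoid

  step : ℕ → ℕ → Carrier
  step x y = if x ≡ᵇ y then p else if x <ᵇ y then r else q

  step-plateau : ∀ x → step x x ≡ p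
  step-plateau x rewrite dec-true (x ≟ x) ≡.refl = ≡.refl

  step-ascent : ∀ {x y} → x < y → step x y ≡ r
  step-ascent {x} {y} x<y rewrite dec-false (x ≟ y) (ℕ.<⇒≢ x<y) | dec-true (x <? y) x<y = ≡.refl

  step-descent : ∀ {x y} → y < x → step x y ≡ q
  step-descent {x} {y} y<x rewrite dec-false (x ≟ y) (ℕ.>⇒≢ y<x) | dec-false (x <? y) (ℕ.<⇒≯ y<x) = ≡.refl

  -- The product of the steps of w followed by the end marker e.  With e = 0 the final descent
  -- accounts for the factor q in f = q C - q + 1.
  W : ℕ → List ℕ → Carrier
  W e []          = 1#
  W e (x ∷ [])    = step x e
  W e (x ∷ y ∷ w) = step x y * W e (y ∷ w)

  W-++ : ∀ e A x D → W e (A ++ x ∷ D) ≈ W x A * W e (x ∷ D)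
  W-++ e []           x D = sym (*-identityˡ _)
  W-++ e (a ∷ [])     x D = refl
  W-++ e (a ∷ b ∷ A)  x D = trans (*-congˡ (W-++ e (b ∷ A) x D)) (sym (*-assoc _ _ _))

  W-suc : ∀ e w → W (suc e) (map suc w) ≡ W e w
  W-suc e []          = ≡.refl
  W-suc e (x ∷ [])    = ≡.refl
  W-suc e (x ∷ y ∷ w) = ≡.cong (step x y *_) (W-suc e (y ∷ w))

  -- Only the last letter sees the end marker, and any marker below it produces a descent.
  W-end : ∀ {e e′} w → (∀ {i} → i ∈ w → e < i) → (∀ {i} → i ∈ w → e′ < i) → W e w ≡ W e′ w
  W-end []          e< e′< = ≡.refl
  W-end (x ∷ [])    e< e′< = ≡.trans (step-descent (e< (here ≡.refl))) (≡.sym (step-descent (e′< (here ≡.refl))))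
  W-end (x ∷ y ∷ w) e< e′< = ≡.cong (step x y *_) (W-end (y ∷ w) (e< ∘ there) (e′< ∘ there))

  -- Each doubled letter contributes its own plateau and the descent to whatever follows.
  W-double : ∀ e B → StrictlyDecreasing B → (∀ {i} → i ∈ B → e < i) → W e (double B) ≈ pow (p * q) (length B)
  W-double e []          dec e< = refl
  W-double e (x ∷ [])    dec e< = begin
    step x x * step x e   ≈⟨ *-cong (reflexive (step-plateau x)) (reflexive (step-descent (e< (here ≡.refl)))) ⟩
    p * q                 ≈⟨ *-identityʳ _ ⟨
    p * q * 1#            ∎
  W-double e (x ∷ y ∷ B) dec e< = begin
    step x x * (step x y * W e (double (y ∷ B)))   ≈⟨ *-assoc _ _ _ ⟨
    step x x * step x y * W e (double (y ∷ B))     ≈⟨ *-cong (*-cong (reflexive (step-plateau x)) (reflexive (step-descent (dec (≡.refl ∷ ≡.refl ∷ minimum B)))))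
                                                        (W-double e (y ∷ B) (λ τ → dec (x ∷ʳ τ)) (e< ∘ there)) ⟩
    p * q * pow (p * q) (length (y ∷ B))           ∎

  pow-+ : ∀ x m n → pow x (m ℕ.+ n) ≈ pow x m * pow x n
  pow-+ x zero    n = sym (*-identityˡ _)
  pow-+ x (suc m) n = trans (*-congˡ (pow-+ x m n)) (sym (*-assoc _ _ _))

  -- `A` is closed by the marker `e`, not by the first letter of `B`: 0 for a finished word, 1 when
  -- a new 1 is about to be placed behind `A`.
  weight : ℕ → Marked → Carrier
  weight e (A , B) = W e A * pow (p * q) (length B)

  total : {S : Set} → (S → Carrier) → List S → Carrier
  total g xs = sumL (map g xs)

  total-++ : ∀ {S : Set} (g : S → Carrier) xs ys → total g (xs ++ ys) ≈ total g xs + total g ys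
  total-++ g []       ys = sym (+-identityˡ _)
  total-++ g (x ∷ xs) ys = trans (+-congˡ (total-++ g xs ys)) (sym (+-assoc _ _ _))

  total-concat : ∀ {S : Set} (g : S → Carrier) (F : ℕ → List S) k →
                 total g (concat (applyUpTo F k)) ≈ Σ< k (λ t → total g (F t))
  total-concat g F zero    = refl
  total-concat g F (suc k) = trans (total-++ g (F 0) _) (+-congˡ (total-concat g (λ t → F (suc t)) k))

  total-map : ∀ {S S′ : Set} (g : S′ → Carrier) (h : S → Carrier) (f : S → S′) x xs →
              (∀ {s} → s ∈ xs → g (f s) ≈ x * h s) → total g (map f xs) ≈ x * total h xs
  total-map g h f x []       eq = sym (zeroʳ x)
  total-map g h f x (s ∷ xs) eq =
    trans (+-cong (eq (here ≡.refl)) (total-map g h f x xs (eq ∘ there))) (sym (distribˡ x _ _))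

  total-↭ : ∀ {S : Set} (g : S → Carrier) {xs ys} → xs ↭ ys → total g xs ≈ total g ys
  total-↭ g _↭_.refl = refl
  total-↭ g (prep x xs↭ys) = +-congˡ (total-↭ g xs↭ys)
  total-↭ g (swap x y xs↭ys) = trans (sym (+-assoc _ _ _)) (trans (+-cong (+-comm _ _) (total-↭ g xs↭ys)) (+-assoc _ _ _))
  total-↭ g (_↭_.trans xs↭ys ys↭zs) = trans (total-↭ g xs↭ys) (total-↭ g ys↭zs)

  W-one-double : ∀ e B → e ≤ 1 → StrictlyDecreasing B → (∀ {i} → i ∈ B → 1 < i) → 1 ≤ length B →
                 W e (1 ∷ double B) ≈ r * pow (p * q) (length B)
  W-one-double e (x ∷ B) e≤1 dec 1<B _ = *-cong (reflexive (step-ascent (1<B (here ≡.refl))))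
    (W-double e (x ∷ B) dec (λ i∈ → ℕ.≤-<-trans e≤1 (1<B i∈)))

  weight-insertOne-suc : ∀ {e t A B} → e ≤ 1 → t < length B → StrictlyDecreasing B → (∀ {i} → i ∈ B → 1 < i) →
                         weight e (insertOne (suc t) (A , B)) ≈ r * weight 1 (A , B)
  weight-insertOne-suc {e} {t} {A} {B} e≤1 t<B dec 1<B = begin
    W e (A ++ 1 ∷ double B₁) * P (length B₂)         ≈⟨ *-congʳ (W-++ e A 1 (double B₁)) ⟩
    W 1 A * W e (1 ∷ double B₁) * P (length B₂)      ≈⟨ *-congʳ (*-congˡ (W-one-double e B₁ e≤1
                                                          (λ τ → dec (⊆-trans (++⁺ʳ B₂ τ) (⊆-reflexive (take++drop≡id (suc t) B))))
                                                          (λ i∈ → 1<B (∈-take (suc t) i∈)) 1≤B₁)) ⟩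
    W 1 A * (r * P (length B₁)) * P (length B₂)      ≈⟨ *-congʳ (x∙yz≈y∙xz _ _ _) ⟩
    r * (W 1 A * P (length B₁)) * P (length B₂)      ≈⟨ *-assoc _ _ _ ⟩
    r * (W 1 A * P (length B₁) * P (length B₂))      ≈⟨ *-congˡ (*-assoc _ _ _) ⟩
    r * (W 1 A * (P (length B₁) * P (length B₂)))    ≈⟨ *-congˡ (*-congˡ (pow-+ (p * q) (length B₁) (length B₂))) ⟨
    r * (W 1 A * P (length B₁ ℕ.+ length B₂))        ≡⟨ ≡.cong (λ k → r * (W 1 A * P k)) (≡.trans (≡.sym (length-++ B₁))
                                                          (≡.cong length (take++drop≡id (suc t) B))) ⟩
    r * (W 1 A * P (length B))                       ∎
    where
    P : ℕ → Carrier
    P = pow (p * q)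
    B₁ B₂ : List ℕ
    B₁ = take (suc t) B
    B₂ = drop (suc t) B
    1≤B₁ : 1 ≤ length B₁
    1≤B₁ = ≡.subst (1 ≤_) (≡.sym (≡.trans (length-take (suc t) B) (ℕ.m≤n⇒m⊓n≡m t<B))) (s≤s z≤n)

  weight-insertOne-zero : ∀ e A B → weight e (insertOne 0 (A , B)) ≈ step 1 e * weight 1 (A , B)
  weight-insertOne-zero e A B = begin
    W e (A ++ 1 ∷ []) * P                ≈⟨ *-congʳ (W-++ e A 1 []) ⟩
    W 1 A * step 1 e * P                 ≈⟨ *-congʳ (*-comm _ _) ⟩
    step 1 e * W 1 A * P                 ≈⟨ *-assoc _ _ _ ⟩
    step 1 e * (W 1 A * P)               ∎
    where
    P : Carrier
    P = pow (p * q) (length B)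

  -- With nothing released the new 1 steps directly to the marker, and `step 1 e` is `p` if the
  -- second 1 comes next (`e = 1`) and `q` if the word is finished (`e = 0`). Otherwise there is one
  -- ascent `r`, and the released letters keep their weight.
  total-insertions : ∀ {L} → IsLevelled L → ∀ e → e ≤ 1 → ∀ m →
    total (weight e) (insertions L m) ≈ T (step 1 e) (λ k → total (weight 1) (L k)) m
  total-insertions {L} lev e e≤1 m = begin
    total (weight e) (insertions L m)
      ≈⟨ total-concat (weight e) (insertionsAt L m) (suc N) ⟩
    Σ< (suc N) (λ t → total (weight e) (insertionsAt L m t))
      ≈⟨ +-cong (total-map (weight e) (weight 1) (insertOne 0) (step 1 e) (L m) (λ {(A , B)} _ → weight-insertOne-zero e A B))
                (Σ<-cong N (λ t → total-map (weight e) (weight 1) (insertOne (suc t)) r (L (suc t ℕ.+ m))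
                  (λ {(A , B)} s∈ → weight-insertOne-suc {A = A} e≤1
                    (≡.subst (t <_) (≡.sym (length≡ s∈)) (s≤s (ℕ.m≤m+n t m))) (decreasing s∈) (1< s∈)))) ⟩
    step 1 e * total (weight 1) (L m) + Σ< N (λ t → r * total (weight 1) (L (suc t ℕ.+ m)))
      ≈⟨ +-congˡ (Σ<-distribˡ N r _) ⟨
    T (step 1 e) (λ k → total (weight 1) (L k)) m ∎
    where open IsLevelled lev

  total-shifted : ∀ n m → total (weight 1) (shifted n m) ≈ total (weight 0) (marked n m)
  total-shifted n m = trans (total-map (weight 1) (weight 0) shiftUp 1# (marked n m) (λ {(A , B)} _ →
    trans (*-cong (reflexive (W-suc 0 A)) (reflexive (≡.cong (pow (p * q)) (length-map suc B)))) (sym (*-identityˡ _))))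
    (*-identityˡ _)

  total-appended : ∀ n m → total (weight 0) (appended n (suc m)) ≈ p * q * total (weight 0) (marked n m)
  total-appended n m = trans (total-map (weight 0) (weight 1) appendOne (p * q) (shifted n m) factor)
                             (*-congˡ (total-shifted n m))
    where
    factor : ∀ {s} → s ∈ shifted n m → weight 0 (appendOne s) ≈ p * q * weight 1 s
    factor s∈ with (A , B) , s∈′ , ≡.refl ← ∈-map⁻ shiftUp s∈ = begin
      W 0 (map suc A) * pow (p * q) (length (map suc B ++ 1 ∷ []))
        ≈⟨ *-cong (reflexive (W-end (map suc A) (λ i∈ → ℕ.<⇒≤ (1<A i∈)) 1<A))
                  (reflexive (≡.cong (pow (p * q)) (≡.trans (length-++ (map suc B)) (ℕ.+-comm _ 1)))) ⟩
      W 1 (map suc A) * (p * q * pow (p * q) (length (map suc B)))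
        ≈⟨ x∙yz≈y∙xz _ _ _ ⟩
      p * q * (W 1 (map suc A) * pow (p * q) (length (map suc B))) ∎
      where
      1<A : ∀ {i} → i ∈ map suc A → 1 < i
      1<A i∈ with _ , j∈ , ≡.refl ← ∈-map⁻ suc i∈ = s≤s (Sound.positiveˡ (sound n m s∈′) j∈)

  total-marked : ∀ n m → total (weight 0) (marked n m) ≈ a n m
  total-inserted : ∀ n m → total (weight 0) (insertions (insertions (shifted n)) m) ≈ T q (T p (a n)) m

  total-marked zero    zero    = trans (+-identityʳ _) (*-identityʳ 1#)
  total-marked zero    (suc m) = refl
  total-marked (suc n) zero    = total-inserted n zero
  total-marked (suc n) (suc m) = trans (total-++ (weight 0) (appended n (suc m)) _)
    (+-cong (trans (total-appended n m) (*-congˡ (total-marked n m))) (total-inserted n (suc m)))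

  total-inserted n m = begin
    total (weight 0) (insertions (insertions (shifted n)) m)
      -- The outer insertion places the second 1, closed by the marker 0; the inner one places the
      -- first 1, whose marker 1 stands for the second.
      ≈⟨ total-insertions (insertions-levelled (shifted-levelled n)) 0 z≤n m ⟩
    T q (λ k → total (weight 1) (insertions (shifted n) k)) m
      ≈⟨ T-cong q (total-insertions (shifted-levelled n) 1 ℕ.≤-refl) m ⟩
    T q (T p (λ k → total (weight 1) (shifted n k))) m
      ≈⟨ T-cong q (T-cong p (λ k → trans (total-shifted n k) (total-marked n k))) m ⟩
    T q (T p (a n)) m ∎

  monomial : List ℕ → Carrier
  monomial w = pow p (plat w) * pow q (des w) * pow r (asc w)

  monomial-∷ : ∀ x y w → monomial (x ∷ y ∷ w) ≈ step x y * monomial (y ∷ w)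
  monomial-∷ x y w with ℕ.<-cmp x y
  ... | tri≈ _ ≡.refl _
      rewrite dec-true (x ≟ x) ≡.refl | dec-false (x <? x) (ℕ.<-irrefl ≡.refl) =
        trans (*-congʳ (*-assoc _ _ _)) (*-assoc _ _ _)
  ... | tri< x<y x≢y y≮x
      rewrite dec-false (x ≟ y) x≢y | dec-true (x <? y) x<y | dec-false (y <? x) y≮x = x∙yz≈y∙xz _ _ _
  ... | tri> x≮y x≢y y<x
      rewrite dec-false (x ≟ y) x≢y | dec-false (x <? y) x≮y | dec-true (y <? x) y<x =
        trans (*-congʳ (x∙yz≈y∙xz _ _ _)) (*-assoc _ _ _)

  W≈q*monomial : ∀ x w → (∀ {i} → i ∈ x ∷ w → 0 < i) → W 0 (x ∷ w) ≈ q * monomial (x ∷ w)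
  W≈q*monomial x []      0< = trans (reflexive (step-descent (0< (here ≡.refl))))
    (sym (trans (*-congˡ (trans (*-identityʳ _) (*-identityʳ _))) (*-identityʳ q)))
  W≈q*monomial x (y ∷ w) 0< = begin
    step x y * W 0 (y ∷ w)              ≈⟨ *-congˡ (W≈q*monomial y w (0< ∘ there)) ⟩
    step x y * (q * monomial (y ∷ w))   ≈⟨ x∙yz≈y∙xz _ _ _ ⟩
    q * (step x y * monomial (y ∷ w))   ≈⟨ *-congˡ (monomial-∷ x y w) ⟨
    q * monomial (x ∷ y ∷ w)            ∎

  f≈a : ∀ n → n ≤ N → (((q · C123 p q r) ⊝ κ q) ⊕ κ 1#) n ≈ a n 0
  -- The empty word has no last letter and so no final descent: `- q + 1` replaces its contribution
  -- q to q C by 1.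
  f≈a zero    _   = begin
    (q * (1# * 1# * 1# + 0#) - q) + 1#   ≈⟨ +-congʳ (+-congʳ (trans (*-congˡ (trans (+-identityʳ _)
                                              (trans (*-identityʳ _) (*-identityʳ _)))) (*-identityʳ q))) ⟩
    (q - q) + 1#                         ≈⟨ +-congʳ (-‿inverseʳ q) ⟩
    0# + 1#                              ≈⟨ +-identityˡ 1# ⟩
    1#                                   ∎
  f≈a (suc n) n<N = begin
    (q * C123 p q r (suc n) - 0#) + 0#                     ≈⟨ trans (+-identityʳ _) (trans (+-congˡ ε⁻¹≈ε) (+-identityʳ _)) ⟩
    q * C123 p q r (suc n)                                 ≈⟨ total-map (weight 0) monomial (_, []) q (Q123 (suc n)) word ⟨
    total (weight 0) (map (_, []) (Q123 (suc n)))          ≈⟨ total-↭ (weight 0) (Q123↭marked (suc n) n<N) ⟩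
    total (weight 0) (marked (suc n) 0)                    ≈⟨ total-marked (suc n) 0 ⟩
    a (suc n) 0                                            ∎
    where
    open GroupProperties +-group using (ε⁻¹≈ε)
    word : ∀ {w} → w ∈ Q123 (suc n) → weight 0 (w , []) ≈ q * monomial w
    word {[]}    w∈ with () ← Valid.length≡ (∈Q123⇒valid (suc n) w∈)
    word {x ∷ w} w∈ = trans (*-identityʳ _) (W≈q*monomial x w (proj₁ ∘ Valid.range (∈Q123⇒valid (suc n) w∈)))

theorem2p6 : {c ℓ : Level} (R : CommutativeRing c ℓ) →
    let open CommutativeRing R
        open PowerSeries R
    in (p q r : Carrier) →
       let f = ((q · C123 p q r) ⊝ κ q) ⊕ κ 1#
       in (n : ℕ) →
          f n ≈ (κ 1# ⊕ (((p * q) · X· (((⊖ (κ 1#))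
                   ⊕ ((κ (1# + 1#) ⊕ X· (κ (p * r + q * r - p * q))) ⊗ f))
                   ⊝ (((p * q) · X· (κ 1# ⊝ X· (κ ((p - r) * (q - r))))) ⊗ (f ⊗ f)))) ⊗ f)) n
-- The cutoff is `N = n`, chosen anew for every coefficient, so the comparison up to order `N` just
-- reaches it.
theorem2p6 R p q r n = cubic R p q r n _ (Weights.f≈a R p q r n) n ℕ.≤-refl
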